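{- Let $G$ be a finite connected graph with nonempty $2$-core $K:=\mathrm{core}_2(G)\neq\varnothing$. Then $$\mathrm{DN}_{\mathrm{LLY}}(G)<\infty\quad\Longleftrightarrow\quad \mathrm{DN}_{\mathrm{LLY}}(\widehat K_G)<\infty .$$
   Context: Graphs are simple and undirected. Let $d(\cdot,\cdot)$ be the combinatorial graph distance. For a positive edge weight $w:E\to(0,\infty)$ put $d_x^w:=\sum_{y\sim x}w_{xy}$. For $\alpha\in[0,1]$ let $\mu_x^{\alpha,w}$ be the probability measure with $\mu_x^{\alpha,w}(x)=\alpha$, $\mu_x^{\alpha,w}(z)=(1-\alpha)w_{xz}/d_x^w$ for $z\sim x$, and $0$ otherwise. Let $W_1$ be the $1$-Wasserstein distance with respect to $d$. For $x\sim y$ let $\kappa_\alpha^w(x,y):=1-W_1(\mu_x^{\alpha,w},\mu_y^{\alpha,w})$ and define the weighted Lin--Lu--Yau curvature $\kappa_{\mathrm{LLY}}^w(x,y):=\lim_{\alpha\to1^- }\kappa_\alpha^w(x,y)/(1-\alpha)$. For connected locally finite $G$ with $E\neq\varnothing$: $\mathrm{Dist}(w):=\sup_{e\in E}w_e/\inf_{e\in E}w_e$, with value $+\infty$ if the supremum is infinite or the infimum is $0$; a positive weight $w$ is admissible if $\kappa_{\mathrm{LLY}}^w(e)\ge0$ for every $e\in E$; and $\mathrm{DN}_{\mathrm{LLY}}(G):=\inf\{\mathrm{Dist}(w): w \text{ admissible}\}$, with value $+\infty$ if no admissible weight has finite distortion. By convention $\mathrm{DN}_{\mathrm{LLY}}(K_1)=1$.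 The $2$-core $\mathrm{core}_2(G)$ of a finite graph $G$ is the unique maximal subgraph of minimum degree at least $2$ (equivalently, what remains after repeatedly deleting vertices of degree $0$ or $1$). With $K=\mathrm{core}_2(G)$, let $A_G:=\{x\in V(K): x \text{ has a neighbor (in } G)\text{ in } V(G)\setminus V(K)\}$. The graph $\widehat K_G$ is obtained from $K$ by attaching exactly one new pendant vertex $x^\partial$ to each $x\in A_G$ (via the edge $xx^\partial$). -}

module Defs where

open import Algebra.Structures using (IsCommutativeRing)
import Algebra.Definitions.RawMonoid as RawMonoidDefinitions
open import Algebra.Bundles.Raw using (RawMonoid)
open import Data.Bool.Base using (Bool; false; T; not; if_then_else_; _∧_)
open import Data.Bool.ListAction using (any)
open import Data.Bool.Properties using (T-irrelevant; T?)
open import Data.Empty using (⊥)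
open import Data.List.Base using (List; []; _∷_; _++_; map; foldr; filterᵇ; length)
open import Data.List.Membership.Propositional using (_∈_)
open import Data.List.Membership.Propositional.Properties using (∈-map⁺; ∈-++⁺ˡ; ∈-++⁺ʳ; ∈-map⁻)
open import Data.List.Relation.Unary.All as All using (All; []; _∷_)
open import Data.List.Relation.Unary.AllPairs using ([]; _∷_)
open import Data.List.Relation.Unary.Any using (here; there)
open import Data.List.Relation.Unary.Unique.Propositional using (Unique)
import Data.List.Relation.Unary.Unique.Propositional.Properties as Unique
open import Data.Nat.Base as ℕ using (ℕ; zero; suc)
open import Data.Product using (Σ; ∃; ∃-syntax; Σ-syntax; _×_; _,_; proj₁)
import Data.Product.Properties as Product
open import Data.Sum.Base using (_⊎_; inj₁; inj₂)
import Data.Sum.Properties as Sum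
open import Data.Sum.Properties using (inj₁-injective; inj₂-injective)
open import Data.Unit.Base using (⊤)
open import Relation.Binary.Definitions using (DecidableEquality)
open import Relation.Binary.PropositionalEquality using (_≡_; _≢_; refl; sym; cong)
open import Relation.Binary.Structures using (IsDecTotalOrder)
import Relation.Binary.Construct.NonStrictToStrict as ToStrict
open import Relation.Nullary using (¬_; yes; no; contradiction)
open import Relation.Nullary.Decidable using (⌊_⌋; toWitness; fromWitness)

------------------------------------------------------------------------
-- The real numbers

module Bounds {A : Set} (_≤_ : A → A → Set) where

  UpperBound LowerBound IsSup IsInf : (A → Set) → A → Set
  UpperBound P b = ∀ x → P x → x ≤ b
  LowerBound P b = ∀ x → P x → b ≤ x
  IsSup P s = UpperBound P s × (∀ b → UpperBound P b → s ≤ b)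
  IsInf P i = LowerBound P i × (∀ b → LowerBound P b → b ≤ i)

-- The library has no real numbers.  ℝ is presented by its classical
-- characterisation as the complete ordered field, unique up to isomorphism.
-- The order is classical, hence decidable.  The inverse is a total operation
-- whose value at 0 is left unspecified.

record CompleteOrderedField : Set₁ where
  infix  4 _≈_ _≤_
  infixl 6 _+_ _-_
  infixl 7 _*_
  infix  8 -_ _⁻¹
  field
    Carrier           : Set
    _≈_ _≤_           : Carrier → Carrier → Set
    _+_ _*_           : Carrier → Carrier → Carrier
    -_ _⁻¹            : Carrier → Carrier
    0# 1#             : Carrier
    isCommutativeRing : IsCommutativeRing _≈_ _+_ _*_ -_ 0# 1#
    1≉0               : ¬ (1# ≈ 0#)
    ⁻¹-cong           : ∀ {x y} → x ≈ y → x ⁻¹ ≈ y ⁻¹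
    ⁻¹-inverse        : ∀ x → ¬ (x ≈ 0#) → x * x ⁻¹ ≈ 1#
    isDecTotalOrder   : IsDecTotalOrder _≈_ _≤_
    +-monoˡ-≤         : ∀ z {x y} → x ≤ y → x + z ≤ y + z
    *-nonneg          : ∀ {x y} → 0# ≤ x → 0# ≤ y → 0# ≤ x * y

  open Bounds _≤_ public

  field
    complete : (P : Carrier → Set) → ∃ P → ∃ (UpperBound P) → ∃ (IsSup P)

  open ToStrict _≈_ _≤_ public using (_<_)

  _-_ : Carrier → Carrier → Carrier
  x - y = x + (- y)

  +-rawMonoid : RawMonoid _ _
  +-rawMonoid = record { _≈_ = _≈_ ; _∙_ = _+_ ; ε = 0# }

  -- n · x is the n-fold sum x + ⋯ + x.
  open RawMonoidDefinitions +-rawMonoid public using () renaming (_×_ to _·_)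

------------------------------------------------------------------------
-- Finite simple graphs

record FiniteGraph : Set₁ where
  field
    V        : Set
    _≟_      : DecidableEquality V
    vertices : List V
    complete : ∀ x → x ∈ vertices
    unique   : Unique vertices
    adj      : V → V → Bool
    adj-sym  : ∀ x y → T (adj x y) → T (adj y x)
    adj-irr  : ∀ x → ¬ T (adj x x)

module _ (G : FiniteGraph) where
  open FiniteGraph G

  data Walk : V → V → ℕ → Set where
    nil  : ∀ {x} → Walk x x zero
    step : ∀ {x y z n} → T (adj x y) → Walk y z n → Walk x z (suc n)

Connected : FiniteGraph → Set
Connected G = ∀ x y → ∃[ n ] Walk G x y n
  where open FiniteGraph G

HasEdge : FiniteGraph → Set
HasEdge G = ∃[ x ] ∃[ y ] T (adj x y)
  where open FiniteGraph G

-- The combinatorial distance, specified by its defining property.  It exists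
-- exactly when the graph is connected, and is then unique.
record GraphDistance (G : FiniteGraph) : Set where
  open FiniteGraph G
  field
    d        : V → V → ℕ
    attained : ∀ x y → Walk G x y (d x y)
    minimal  : ∀ x y n → Walk G x y n → d x y ℕ.≤ n

------------------------------------------------------------------------
-- The 2-core

record Subgraph (G : FiniteGraph) : Set where
  open FiniteGraph G
  field
    vert      : V → Bool
    edge      : V → V → Bool
    edge-sym  : ∀ x y → T (edge x y) → T (edge y x)
    edge-vert : ∀ x y → T (edge x y) → T (vert x)
    edge-adj  : ∀ x y → T (edge x y) → T (adj x y)

  degree : V → ℕ
  degree x = length (filterᵇ (edge x) vertices)

  MinDegree≥2 : Set
  MinDegree≥2 = ∀ x → T (vert x) → 2 ℕ.≤ degree x

  Nonempty : Set
  Nonempty = ∃[ x ] T (vert x)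

infix 4 _⊑_

_⊑_ : ∀ {G} → Subgraph G → Subgraph G → Set
H ⊑ K = (∀ x → T (vert H x) → T (vert K x))
      × (∀ x y → T (edge H x y) → T (edge K x y))
  where open Subgraph

Is2Core : ∀ {G} → Subgraph G → Set
Is2Core {G} K = MinDegree≥2 K × (∀ H → MinDegree≥2 H → K ⊑ H → H ⊑ K)
  where open Subgraph

------------------------------------------------------------------------
-- The graph K̂

-- Enumerating a decidable subset of an enumerated type.
module _ {A : Set} (p : A → Bool) where

  restrict : List A → List (Σ[ x ∈ A ] T (p x))
  restrict []       = []
  restrict (x ∷ xs) with T? (p x)
  ... | yes px = (x , px) ∷ restrict xs
  ... | no  _  = restrict xs

  ∈-restrict : ∀ xs {x} (px : T (p x)) → x ∈ xs → (x , px) ∈ restrict xs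
  ∈-restrict (x ∷ xs) px (here refl) with T? (p x)
  ... | yes px′ = here (cong (x ,_) (T-irrelevant px px′))
  ... | no ¬px  = contradiction px ¬px
  ∈-restrict (x ∷ xs) px (there y∈xs) with T? (p x)
  ... | yes _ = there (∈-restrict xs px y∈xs)
  ... | no  _ = ∈-restrict xs px y∈xs

  restrict-fresh : ∀ {x} (px : T (p x)) xs → All (x ≢_) xs →
                   All ((x , px) ≢_) (restrict xs)
  restrict-fresh px []       []           = []
  restrict-fresh px (y ∷ xs) (x≢y ∷ x≢xs) with T? (p y)
  ... | yes _ = (λ eq → x≢y (cong proj₁ eq)) ∷ restrict-fresh px xs x≢xs
  ... | no  _ = restrict-fresh px xs x≢xs

  restrict-unique : ∀ xs → Unique xs → Unique (restrict xs)
  restrict-unique []       []           = []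
  restrict-unique (x ∷ xs) (x≢xs ∷ uxs) with T? (p x)
  ... | yes px = restrict-fresh px xs x≢xs ∷ restrict-unique xs uxs
  ... | no  _  = restrict-unique xs uxs

  restrict-≟ : DecidableEquality A → DecidableEquality (Σ[ x ∈ A ] T (p x))
  restrict-≟ _≟_ = Product.≡-dec _≟_ (λ a b → yes (T-irrelevant a b))

module _ {G : FiniteGraph} (K : Subgraph G) where
  open FiniteGraph G
  open Subgraph K

  -- The set A_G.
  attachment : V → Bool
  attachment x = vert x ∧ any (λ z → adj x z ∧ not (vert z)) vertices

  -- inj₁ : vertices of K;  inj₂ (x , _) : the pendant vertex x^∂, x ∈ A_G.
  V^ : Set
  V^ = (Σ[ x ∈ V ] T (vert x)) ⊎ (Σ[ x ∈ V ] T (attachment x))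

  adj^ : V^ → V^ → Bool
  adj^ (inj₁ (x , _)) (inj₁ (y , _)) = edge x y
  adj^ (inj₁ (x , _)) (inj₂ (y , _)) = ⌊ x ≟ y ⌋
  adj^ (inj₂ (x , _)) (inj₁ (y , _)) = ⌊ x ≟ y ⌋
  adj^ (inj₂ _)       (inj₂ _)       = false

  private
    core    = restrict vert vertices
    pendant = restrict attachment vertices

    completê : ∀ x → x ∈ map inj₁ core ++ map inj₂ pendant
    completê (inj₁ (x , p)) =
      ∈-++⁺ˡ (∈-map⁺ inj₁ (∈-restrict vert vertices p (complete x)))
    completê (inj₂ (x , p)) =
      ∈-++⁺ʳ (map inj₁ core)
        (∈-map⁺ inj₂ (∈-restrict attachment vertices p (complete x)))

    disjoint : ∀ {x} → ¬ (x ∈ map inj₁ core × x ∈ map inj₂ pendant)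
    disjoint (x∈₁ , x∈₂) with ∈-map⁻ inj₁ x∈₁ | ∈-map⁻ inj₂ x∈₂
    ... | _ , _ , refl | _ , _ , ()

    flip-≟ : ∀ {x y} → T ⌊ x ≟ y ⌋ → T ⌊ y ≟ x ⌋
    flip-≟ {x} {y} t = fromWitness {a? = y ≟ x} (sym (toWitness {a? = x ≟ y} t))

    sym^ : ∀ x y → T (adj^ x y) → T (adj^ y x)
    sym^ (inj₁ (x , _)) (inj₁ (y , _)) t = edge-sym x y t
    sym^ (inj₁ _)       (inj₂ _)       t = flip-≟ t
    sym^ (inj₂ _)       (inj₁ _)       t = flip-≟ t

    irr^ : ∀ x → ¬ T (adj^ x x)
    irr^ (inj₁ (x , _)) t = adj-irr x (edge-adj x x t)

  K̂ : FiniteGraph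
  K̂ = record
    { V        = V^
    ; _≟_      = Sum.≡-dec (restrict-≟ vert _≟_) (restrict-≟ attachment _≟_)
    ; vertices = map inj₁ core ++ map inj₂ pendant
    ; complete = completê
    ; unique   = Unique.++⁺ (Unique.map⁺ inj₁-injective (restrict-unique vert vertices unique))
                            (Unique.map⁺ inj₂-injective (restrict-unique attachment vertices unique))
                            disjoint
    ; adj      = adj^
    ; adj-sym  = sym^
    ; adj-irr  = irr^
    }

------------------------------------------------------------------------
-- Weighted Lin–Lu–Yau curvature and the distortion number

module Curvature (ℛ : CompleteOrderedField) (G : FiniteGraph) where
  open CompleteOrderedField ℛ renaming (Carrier to ℝ) hiding (complete)
  open FiniteGraph G

  ∑ : (V → ℝ) → ℝ
  ∑ f = foldr _+_ 0# (map f vertices)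

  -- A positive weight E → (0,∞), extended by 0 to the pairs that are not edges.
  record Weight : Set where
    field
      w        : V → V → ℝ
      w-sym    : ∀ x y → w x y ≈ w y x
      positive : ∀ x y → T (adj x y) → 0# < w x y
      off-edge : ∀ x y → ¬ T (adj x y) → w x y ≈ 0#

    deg : V → ℝ
    deg x = ∑ (w x)

    EdgeValue : ℝ → Set
    EdgeValue r = ∃[ x ] ∃[ y ] (T (adj x y) × r ≈ w x y)

    μ : ℝ → V → V → ℝ
    μ α x z =
      if ⌊ z ≟ x ⌋ then α
      else if adj x z then (1# - α) * (w x z * (deg x) ⁻¹)
      else 0#

  record Coupling (μ ν : V → ℝ) : Set where
    field
      π         : V → V → ℝ
      nonneg    : ∀ x y → 0# ≤ π x y
      marginalˡ : ∀ x → ∑ (λ y → π x y) ≈ μ x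
      marginalʳ : ∀ y → ∑ (λ x → π x y) ≈ ν y

  -- W₁, κ_α, κ_LLY, Dist and DN are defined by an infimum, limit or supremum;
  -- each is given as a functional relation "the quantity has this value".

  module _ (D : GraphDistance G) where
    open GraphDistance D using (d)

    cost : ∀ {μ ν} → Coupling μ ν → ℝ
    cost c = ∑ λ x → ∑ λ y → d x y · Coupling.π c x y

    IsW₁ : (μ ν : V → ℝ) → ℝ → Set
    IsW₁ μ ν = IsInf (λ r → Σ[ c ∈ Coupling μ ν ] r ≈ cost c)

    module _ (weight : Weight) where
      open Weight weight

      Isκ : ℝ → V → V → ℝ → Set
      Isκ α x y k = ∃[ r ] (IsW₁ (μ α x) (μ α y) r × k ≈ 1# - r)

      IsκLLY : V → V → ℝ → Set
      IsκLLY x y l =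
        ∀ ε → 0# < ε → ∃[ δ ] (0# < δ ×
          (∀ α → 0# ≤ α → α < 1# → 1# - δ < α →
            ∃[ k ] (Isκ α x y k
                   × l - ε < k * (1# - α) ⁻¹
                   × k * (1# - α) ⁻¹ < l + ε)))

      Admissible : Set
      Admissible = ∀ x y → T (adj x y) → ∃[ l ] (IsκLLY x y l × 0# ≤ l)

  data ℝ∞ : Set where
    fin : ℝ → ℝ∞
    ∞   : ℝ∞

  Finite : ℝ∞ → Set
  Finite (fin _) = ⊤
  Finite ∞       = ⊥

  IsDist : Weight → ℝ∞ → Set
  IsDist weight (fin q) =
    ∃[ s ] ∃[ i ] (IsSup EdgeValue s × IsInf EdgeValue i × 0# < i × q ≈ s * i ⁻¹)
    where open Weight weight
  IsDist weight ∞ = ¬ ∃ (UpperBound EdgeValue) ⊎ IsInf EdgeValue 0#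
    where open Weight weight

  AdmissibleDist : GraphDistance G → ℝ → Set
  AdmissibleDist D q = Σ[ weight ∈ Weight ] (Admissible D weight × IsDist weight (fin q))

  -- The infimum over the admissible weights, as an element of (-∞,+∞].
  IsInfDist : GraphDistance G → ℝ∞ → Set
  IsInfDist D (fin r) = ∃ (AdmissibleDist D) × IsInf (AdmissibleDist D) r
  IsInfDist D ∞       = ¬ ∃ (AdmissibleDist D)

  -- The convention for the graph with one vertex.
  IsOne : ℝ∞ → Set
  IsOne (fin r) = r ≈ 1#
  IsOne ∞       = ⊥

  IsDN : ℝ∞ → Set
  IsDN v = Σ[ D ∈ GraphDistance G ]
             ((HasEdge G × IsInfDist D v) ⊎ (¬ HasEdge G × IsOne v))

  DN<∞ : Set
  DN<∞ = ∃[ v ] (IsDN v × Finite v)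

{-# OPTIONS --safe #-}

-- G is K with a tree hanging at each vertex of A_G.  Collapsing the tree at x to x^∂ is a
-- 1-Lipschitz map G → K̂ that pushes the lazy walks at core vertices to lazy walks; hence couplings
-- push forward without increasing their cost, and the pushed weight is admissible on K̂.
-- Conversely the mass at x^∂ can be spread over the tree neighbours of x: distances only grow
-- within one such fibre, and couplings of the walks at two distinct core vertices put no mass there.
-- The remaining edges, pendant or in a tree, are nonnegatively curved as soon as
-- (d_x - w_xy)(d_y - w_xy) ≤ w_xy², which holds if the weights decay fast enough down the trees.
module Submission where

open import Defs
open import Algebra.Bundles using (CommutativeRing; RawRing)
import Algebra.Properties.Ring
import Algebra.Properties.Semiring.Mult
import Algebra.Solver.Ring
open import Algebra.Solver.Ring.AlmostCommutativeRing using (fromCommutativeRing; _-Raw-AlmostCommutative⟶_)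
open import Algebra.Structures using (IsCommutativeRing)
open import Data.Bool.Base using (Bool; true; false; T; not; if_then_else_; _∧_)
open import Data.Bool.Properties using (T?; T-∧; T-irrelevant)
open import Data.List.Base using (List; []; _∷_; map; foldr; filterᵇ; length)
open import Data.List.Membership.Propositional using (_∈_; find; lose)
open import Data.List.Membership.Propositional.Properties using (∈-filter⁺; ∈-filter⁻)
open import Data.List.Relation.Unary.All as All using (_∷_)
open import Data.List.Relation.Unary.AllPairs using (_∷_)
open import Data.List.Relation.Unary.Any as Any using (here; there)
import Data.List.Relation.Unary.Any.Properties as Any
open import Data.List.Relation.Unary.Unique.Propositional using (Unique)
open import Data.Maybe.Base using (Maybe; just; nothing)
open import Data.Nat.Base as ℕ using (ℕ; zero; suc; z≤n; s≤s)
import Data.Nat.Properties as ℕ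
open import Data.Product using (∃; ∃-syntax; Σ-syntax; _×_; _,_; proj₁; proj₂)
open import Data.Sum.Base using (_⊎_; inj₁; inj₂)
open import Data.Unit.Base using (tt)
open import Function.Base using (_∘_; case_of_)
open import Function.Bundles using (_⇔_; mk⇔; module Equivalence)
open import Relation.Binary.Bundles using (Poset)
import Relation.Binary.Construct.NonStrictToStrict as ToStrict
open import Relation.Binary.PropositionalEquality as ≡ using (_≡_; _≢_)
import Relation.Binary.Reasoning.PartialOrder
open import Relation.Binary.Structures using (IsDecTotalOrder)
open import Relation.Nullary using (¬_; Dec; yes; no; contradiction)
open import Relation.Nullary.Decidable using (⌊_⌋; decidable-stable; ¬?; _×-dec_; map′; toWitness; fromWitness; toWitnessFalse; fromWitnessFalse)

-- Ordered fields and finite sums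

-- On a finite graph with an edge every positive weight has finite distortion, so each side of the
-- equivalence asks for nothing but one admissible weight. Admissibility is a condition on a limit,
-- which is awkward to compare across two graphs. It is traded for a statement about single
-- couplings: κ_α / (1 - α) increases with α, hence the limit is nonnegative exactly when for each ε
-- > 0 some α has W₁ ≤ 1 + ε (1 - α). Such a bound passes through any Markov kernel that matches the
-- walks and does not raise costs. The obstacle is on the way back from K̂: the spreading kernel is
-- not 1-Lipschitz. Two distinct children of x are at distance 2, while x^∂ is at distance 0 from
-- itself, so the comparison of costs must look at the support of the coupling. The decay down the
-- trees is quadratic because at the edge of weight u from y to its parent the criterion reads
-- (d_parent - u) · (weight of the child edges of y) ≤ u². With all degrees at most D₀ and at most N
-- children, child weights u² / (N D₀) satisfy it.

module OrderedField (ℛ : CompleteOrderedField) where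
  open CompleteOrderedField ℛ renaming (Carrier to ℝ; complete to sup-exists) public
  open IsCommutativeRing isCommutativeRing public
    using (refl; sym; trans; reflexive;
           +-cong; +-assoc; +-comm; +-identityˡ; +-identityʳ; -‿cong; -‿inverseʳ;
           *-cong; *-assoc; *-comm; *-identityˡ; *-identityʳ; distribˡ; distribʳ; zeroˡ; zeroʳ)
  open IsDecTotalOrder isDecTotalOrder public
    using (antisym; total; _≤?_; _≟_)
    renaming (refl to ≤-refl; trans to ≤-trans; reflexive to ≤-reflexive)

  commutativeRing : CommutativeRing _ _
  commutativeRing = record { isCommutativeRing = isCommutativeRing }

  open CommutativeRing commutativeRing public using (ring; semiring; *-congˡ; *-congʳ; +-congˡ; +-congʳ)
  open Algebra.Properties.Ring ring public using (-‿involutive; -‿distribˡ-*; -‿+-comm)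
  module Mult = Algebra.Properties.Semiring.Mult semiring

  poset : Poset _ _ _
  poset = record { isPartialOrder = IsDecTotalOrder.isPartialOrder isDecTotalOrder }

  module ≤-Reasoning = Relation.Binary.Reasoning.PartialOrder poset

  -- A ring solver over an abstract ring needs coefficients that compute:
  -- the pair (a , b) stands for a - b, and one of a, b is kept equal to 0.
  module RingSolver where
    difference : ℕ → ℕ → ℝ
    difference a b = (a · 1#) - (b · 1#)

    -- The first two clauses make the constants 0 and 1 denote 0# and 1# definitionally.
    ⟦_⟧ : ℕ × ℕ → ℝ
    ⟦ 0 , 0 ⟧ = 0#
    ⟦ 1 , 0 ⟧ = 1#
    ⟦ a , b ⟧ = difference a b

    ⟦⟧-difference : ∀ a b → ⟦ a , b ⟧ ≈ difference a b
    ⟦⟧-difference 0             0       = sym (-‿inverseʳ 0#)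
    ⟦⟧-difference 0             (suc b) = refl
    ⟦⟧-difference 1             0       =
      sym (trans (+-congˡ (trans (sym (+-identityˡ _)) (-‿inverseʳ 0#)))
                 (trans (+-identityʳ _) (+-identityʳ _)))
    ⟦⟧-difference 1             (suc b) = refl
    ⟦⟧-difference (suc (suc a)) b       = refl

    reduce : ℕ → ℕ → ℕ × ℕ
    reduce zero    b       = zero , b
    reduce (suc a) zero    = suc a , zero
    reduce (suc a) (suc b) = reduce a b

    cancel : ∀ x y z → (x + y) - (x + z) ≈ y - z
    cancel x y z = begin-equality
      (x + y) + (- (x + z))       ≈⟨ +-congˡ (-‿+-comm x z) ⟨
      (x + y) + ((- x) + (- z))   ≈⟨ +-assoc x y _ ⟩
      x + (y + ((- x) + (- z)))   ≈⟨ +-congˡ (+-assoc y _ _) ⟨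
      x + ((y + (- x)) + (- z))   ≈⟨ +-congˡ (+-congʳ (+-comm y _)) ⟩
      x + (((- x) + y) + (- z))   ≈⟨ +-congˡ (+-assoc _ y _) ⟩
      x + ((- x) + (y + (- z)))   ≈⟨ +-assoc x _ _ ⟨
      (x + (- x)) + (y + (- z))   ≈⟨ +-congʳ (-‿inverseʳ x) ⟩
      0# + (y + (- z))            ≈⟨ +-identityˡ _ ⟩
      y + (- z)                   ∎
      where open ≤-Reasoning

    reduce-correct : ∀ a b → ⟦ reduce a b ⟧ ≈ difference a b
    reduce-correct zero    b       = ⟦⟧-difference zero b
    reduce-correct (suc a) zero    = ⟦⟧-difference (suc a) zero
    reduce-correct (suc a) (suc b) =
      trans (reduce-correct a b) (sym (cancel 1# (a · 1#) (b · 1#)))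

    coefficients : RawRing _ _
    coefficients = record
      { Carrier = ℕ × ℕ
      ; _≈_     = _≡_
      ; _+_     = λ (a , b) (c , d) → reduce (a ℕ.+ c) (b ℕ.+ d)
      ; _*_     = λ (a , b) (c , d) → reduce (a ℕ.* c ℕ.+ b ℕ.* d) (a ℕ.* d ℕ.+ b ℕ.* c)
      ; -_      = λ (a , b) → b , a
      ; 0#      = 0 , 0
      ; 1#      = 1 , 0
      }

    interchange : ∀ x y z u → (x + y) + (z + u) ≈ (x + z) + (y + u)
    interchange x y z u = begin-equality
      (x + y) + (z + u) ≈⟨ +-assoc x y _ ⟩
      x + (y + (z + u)) ≈⟨ +-congˡ (+-assoc y z u) ⟨
      x + ((y + z) + u) ≈⟨ +-congˡ (+-congʳ (+-comm y z)) ⟩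
      x + ((z + y) + u) ≈⟨ +-congˡ (+-assoc z y u) ⟩
      x + (z + (y + u)) ≈⟨ +-assoc x z _ ⟨
      (x + z) + (y + u) ∎
      where open ≤-Reasoning

    difference-+ : ∀ a b c d → difference (a ℕ.+ c) (b ℕ.+ d) ≈ difference a b + difference c d
    difference-+ a b c d = begin-equality
      ((a ℕ.+ c) · 1#) - ((b ℕ.+ d) · 1#)
        ≈⟨ +-cong (Mult.×-homo-+ 1# a c) (-‿cong (Mult.×-homo-+ 1# b d)) ⟩
      ((a · 1#) + (c · 1#)) - ((b · 1#) + (d · 1#))
        ≈⟨ +-congˡ (-‿+-comm _ _) ⟨
      ((a · 1#) + (c · 1#)) + ((- (b · 1#)) + (- (d · 1#)))
        ≈⟨ interchange _ _ _ _ ⟩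
      difference a b + difference c d ∎
      where open ≤-Reasoning

    difference-neg : ∀ a b → difference b a ≈ - (difference a b)
    difference-neg a b = begin-equality
      (b · 1#) + (- (a · 1#))         ≈⟨ +-comm _ _ ⟩
      (- (a · 1#)) + (b · 1#)         ≈⟨ +-congˡ (-‿involutive _) ⟨
      (- (a · 1#)) + (- (- (b · 1#))) ≈⟨ -‿+-comm _ _ ⟩
      - (difference a b)                     ∎
      where open ≤-Reasoning

    difference-* : ∀ a b c d →
           difference (a ℕ.* c ℕ.+ b ℕ.* d) (a ℕ.* d ℕ.+ b ℕ.* c) ≈ difference a b * difference c d
    difference-* a b c d = begin-equality
      difference (a ℕ.* c ℕ.+ b ℕ.* d) (a ℕ.* d ℕ.+ b ℕ.* c)
        ≈⟨ difference-+ (a ℕ.* c) (a ℕ.* d) (b ℕ.* d) (b ℕ.* c) ⟩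
      difference (a ℕ.* c) (a ℕ.* d) + difference (b ℕ.* d) (b ℕ.* c)
        ≈⟨ +-cong (scale a c d) (scale b d c) ⟩
      (a · 1#) * difference c d + (b · 1#) * difference d c
        ≈⟨ +-congˡ (*-congˡ (difference-neg c d)) ⟩
      (a · 1#) * difference c d + (b · 1#) * (- (difference c d))
        ≈⟨ +-congˡ (trans (*-comm _ _) (trans (sym (-‿distribˡ-* _ _))
            (trans (-‿cong (*-comm _ _)) (-‿distribˡ-* _ _)))) ⟩
      (a · 1#) * difference c d + (- (b · 1#)) * difference c d
        ≈⟨ distribʳ _ _ _ ⟨
      difference a b * difference c d ∎
      where
      open ≤-Reasoning
      scale : ∀ m x y → difference (m ℕ.* x) (m ℕ.* y) ≈ (m · 1#) * difference x y
      scale m x y = begin-equality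
        difference (m ℕ.* x) (m ℕ.* y)
          ≈⟨ +-cong (Mult.×1-homo-* m x) (-‿cong (Mult.×1-homo-* m y)) ⟩
        (m · 1#) * (x · 1#) + (- ((m · 1#) * (y · 1#)))
          ≈⟨ +-congˡ (trans (-‿cong (*-comm _ _)) (trans (-‿distribˡ-* _ _) (*-comm _ _))) ⟩
        (m · 1#) * (x · 1#) + (m · 1#) * (- (y · 1#))
          ≈⟨ distribˡ _ _ _ ⟨
        (m · 1#) * difference x y ∎

    morphism : coefficients -Raw-AlmostCommutative⟶ fromCommutativeRing commutativeRing
    morphism = record
      { ⟦_⟧    = ⟦_⟧
      ; +-homo = λ (a , b) (c , d) → trans (reduce-correct (a ℕ.+ c) (b ℕ.+ d))
                   (trans (difference-+ a b c d) (sym (+-cong (⟦⟧-difference a b) (⟦⟧-difference c d))))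
      ; *-homo = λ (a , b) (c , d) → trans (reduce-correct (a ℕ.* c ℕ.+ b ℕ.* d) (a ℕ.* d ℕ.+ b ℕ.* c))
                   (trans (difference-* a b c d) (sym (*-cong (⟦⟧-difference a b) (⟦⟧-difference c d))))
      ; -‿homo = λ (a , b) → trans (⟦⟧-difference b a)
                   (trans (difference-neg a b) (-‿cong (sym (⟦⟧-difference a b))))
      ; 0-homo = refl
      ; 1-homo = refl
      }

    coefficient≟ : ∀ x y → Maybe (⟦ x ⟧ ≈ ⟦ y ⟧)
    coefficient≟ (a , b) (c , d) with a ℕ.≟ c | b ℕ.≟ d
    ... | yes ≡.refl | yes ≡.refl = just refl
    ... | _          | _          = nothing

    open Algebra.Solver.Ring coefficients (fromCommutativeRing commutativeRing) morphism coefficient≟ public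
      using (solve; _:=_; _:+_; _:*_; _:-_; :-_; con; Polynomial)

    :0 :1 : ∀ {n} → Polynomial n
    :0 = con (0 , 0)
    :1 = con (1 , 0)

  open RingSolver public using (solve; _:=_; _:+_; _:*_; _:-_; :-_; :0; :1)

  +-mono-≤ : ∀ {x y u v} → x ≤ y → u ≤ v → x + u ≤ y + v
  +-mono-≤ {x} {y} {u} {v} x≤y u≤v = begin
    x + u ≤⟨ +-monoˡ-≤ u x≤y ⟩
    y + u ≈⟨ +-comm y u ⟩
    u + y ≤⟨ +-monoˡ-≤ y u≤v ⟩
    v + y ≈⟨ +-comm v y ⟩
    y + v ∎
    where open ≤-Reasoning

  ≤⇒0≤- : ∀ {x y} → x ≤ y → 0# ≤ y - x
  ≤⇒0≤- {x} {y} x≤y = begin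
    0#    ≈⟨ -‿inverseʳ x ⟨
    x - x ≤⟨ +-monoˡ-≤ (- x) x≤y ⟩
    y - x ∎
    where open ≤-Reasoning

  -- Turns an inequality into a ring identity for the solver, with the nonnegative gap `t` as
  -- explicit witness.
  certify : ∀ {x y} t → 0# ≤ t → y ≈ x + t → x ≤ y
  certify {x} {y} t 0≤t eq = begin
    x      ≈⟨ +-identityʳ x ⟨
    x + 0# ≤⟨ +-mono-≤ ≤-refl 0≤t ⟩
    x + t  ≈⟨ eq ⟨
    y      ∎
    where open ≤-Reasoning

  +-nonneg : ∀ {x y} → 0# ≤ x → 0# ≤ y → 0# ≤ x + y
  +-nonneg {x} {y} p q = ≤-trans (≤-reflexive (sym (+-identityˡ 0#))) (+-mono-≤ p q)

  *-monoˡ-≤ : ∀ {x y z} → 0# ≤ z → x ≤ y → z * x ≤ z * y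
  *-monoˡ-≤ {x} {y} {z} 0≤z x≤y = certify (z * (y - x)) (*-nonneg 0≤z (≤⇒0≤- x≤y))
    (solve 3 (λ x y z → z :* y := z :* x :+ z :* (y :- x)) refl x y z)

  *-monoʳ-≤ : ∀ {x y z} → 0# ≤ z → x ≤ y → x * z ≤ y * z
  *-monoʳ-≤ {x} {y} {z} 0≤z x≤y =
    ≤-trans (≤-reflexive (*-comm x z)) (≤-trans (*-monoˡ-≤ 0≤z x≤y) (≤-reflexive (*-comm z y)))

  neg-mono-≤ : ∀ {x y} → x ≤ y → - y ≤ - x
  neg-mono-≤ {x} {y} x≤y = certify (y - x) (≤⇒0≤- x≤y)
    (solve 2 (λ x y → :- x := :- y :+ (y :- x)) refl x y)

  neg-swap-≤ : ∀ {x y} → - x ≤ y → - y ≤ x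
  neg-swap-≤ p = ≤-trans (neg-mono-≤ p) (≤-reflexive (-‿involutive _))

  0≤1 : 0# ≤ 1#
  0≤1 with total 0# 1#
  ... | inj₁ p = p
  ... | inj₂ p = ≤-trans (*-nonneg 0≤-1 0≤-1) (≤-reflexive (solve 0 ((:- :1) :* (:- :1) := :1) refl))
    where
    0≤-1 : 0# ≤ - 1#
    0≤-1 = ≤-trans (≤⇒0≤- p) (≤-reflexive (+-identityˡ _))

  0<1 : 0# < 1#
  0<1 = 0≤1 , 1≉0 ∘ sym

  ≰⇒> : ∀ {x y} → ¬ x ≤ y → y < x
  ≰⇒> = ToStrict.≰⇒> _≈_ _≤_ sym ≤-reflexive total

  <⇒≱ : ∀ {x y} → x < y → ¬ y ≤ x
  <⇒≱ = ToStrict.<⇒≱ _≈_ _≤_ antisym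

  ≮⇒≥ : ∀ {x y} → ¬ x < y → y ≤ x
  ≮⇒≥ = ToStrict.≮⇒≥ _≈_ _≤_ sym _≟_ ≤-reflexive total

  _<?_ : ∀ x y → Dec (x < y)
  x <? y = (x ≤? y) ×-dec ¬? (x ≟ y)

  ≤-<-trans : ∀ {x y z} → x ≤ y → y < z → x < z
  ≤-<-trans p q = ≰⇒> λ r → <⇒≱ q (≤-trans r p)

  <-≤-trans : ∀ {x y z} → x < y → y ≤ z → x < z
  <-≤-trans p q = ≰⇒> λ r → <⇒≱ p (≤-trans q r)

  +-monoˡ-< : ∀ z {x y} → x < y → x + z < y + z
  +-monoˡ-< z {x} {y} p = ≰⇒> λ q → <⇒≱ p (certify (x + z - (y + z)) (≤⇒0≤- q)
    (solve 3 (λ x y z → x := y :+ (x :+ z :- (y :+ z))) refl x y z))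

  <⇒0<- : ∀ {x y} → x < y → 0# < y - x
  <⇒0<- {x} {y} p = ≤-<-trans (≤-reflexive (sym (-‿inverseʳ x))) (+-monoˡ-< (- x) p)

  0<-⇒< : ∀ {x y} → 0# < y - x → x < y
  0<-⇒< p = ≰⇒> λ q → <⇒≱ p (≤-trans (+-monoˡ-≤ _ q) (≤-reflexive (-‿inverseʳ _)))

  *-positive : ∀ {x y} → 0# < x → 0# < y → 0# < x * y
  *-positive {x} {y} 0<x 0<y = *-nonneg (proj₁ 0<x) (proj₁ 0<y) , λ eq → proj₂ 0<y (sym (begin-equality
    y               ≈⟨ *-identityˡ y ⟨
    1# * y          ≈⟨ *-congʳ (⁻¹-inverse x (proj₂ 0<x ∘ sym)) ⟨
    x * x ⁻¹ * y    ≈⟨ solve 3 (λ x i y → x :* i :* y := i :* (x :* y)) refl x (x ⁻¹) y ⟩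
    x ⁻¹ * (x * y)  ≈⟨ *-congˡ eq ⟨
    x ⁻¹ * 0#       ≈⟨ zeroʳ _ ⟩
    0#              ∎))
    where open ≤-Reasoning

  ⁻¹-inverseˡ : ∀ {x} → 0# < x → x ⁻¹ * x ≈ 1#
  ⁻¹-inverseˡ 0<x = trans (*-comm _ _) (⁻¹-inverse _ (proj₂ 0<x ∘ sym))

  ⁻¹-inverseʳ : ∀ {x} → 0# < x → x * x ⁻¹ ≈ 1#
  ⁻¹-inverseʳ 0<x = ⁻¹-inverse _ (proj₂ 0<x ∘ sym)

  ⁻¹-positive : ∀ {x} → 0# < x → 0# < x ⁻¹
  ⁻¹-positive {x} 0<x = ≰⇒> λ x⁻¹≤0 → <⇒≱ 0<1 (begin
    1#        ≈⟨ ⁻¹-inverseʳ 0<x ⟨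
    x * x ⁻¹  ≤⟨ *-monoˡ-≤ (proj₁ 0<x) x⁻¹≤0 ⟩
    x * 0#    ≈⟨ zeroʳ x ⟩
    0#        ∎)
    where open ≤-Reasoning

  ½ : ℝ
  ½ = (1# + 1#) ⁻¹

  0<2 : 0# < 1# + 1#
  0<2 = <-≤-trans 0<1 (certify 1# 0≤1 refl)

  ½+½≈1 : ½ + ½ ≈ 1#
  ½+½≈1 = trans (solve 1 (λ h → h :+ h := h :* (:1 :+ :1)) refl ½) (⁻¹-inverseˡ 0<2)

  midpoint : ∀ {x y} → x < y → ∃[ z ] (x < z × z < y)
  midpoint {x} {y} x<y = x + e
    , 0<-⇒< (<-≤-trans 0<e (≤-reflexive (solve 2 (λ x e → e := x :+ e :- x) refl x e)))
    , 0<-⇒< (<-≤-trans 0<e (≤-reflexive (begin-equality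
        e
          ≈⟨ solve 3 (λ x y h → (y :- x) :* h := (y :- x) :* (h :+ h) :- (y :- x) :* h) refl x y ½ ⟩
        (y - x) * (½ + ½) - e           ≈⟨ +-congʳ (*-congˡ ½+½≈1) ⟩
        (y - x) * 1# - e                ≈⟨ solve 3 (λ x y e → (y :- x) :* :1 :- e := y :- (x :+ e)) refl x y e ⟩
        y - (x + e)                     ∎)))
    where
    open ≤-Reasoning
    e = (y - x) * ½
    0<e = *-positive (<⇒0<- x<y) (⁻¹-positive 0<2)

  -- Negate the supremum of the reflected set. `resp` is needed because - (- x) is only `≈` to x, so
  -- membership has to be carried along `≈`.
  inf-exists : (P : ℝ → Set) → (∀ {x y} → x ≈ y → P x → P y) →
               ∃ P → ∃ (LowerBound P) → ∃ (IsInf P)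
  inf-exists P resp (x , px) (b , lb)
    with sup-exists (λ y → P (- y)) (- x , resp (sym (-‿involutive x)) px)
                    (- b , λ y py → ≤-trans (≤-reflexive (sym (-‿involutive y))) (neg-mono-≤ (lb _ py)))
  ... | s , ub , least = - s
      , (λ y py → neg-swap-≤ (ub (- y) (resp (sym (-‿involutive y)) py)))
      , (λ c lc → ≤-trans (≤-reflexive (sym (-‿involutive c)))
          (neg-mono-≤ (least (- c) λ y py → ≤-trans (≤-reflexive (sym (-‿involutive y)))
              (neg-mono-≤ (lc _ py)))))

  -- An arbitrary `P` is not decidable, so the element exceeding b exists only up to double
  -- negation. That is enough for order goals, which are decidable and hence stable.
  not-bound⇒¬¬exceeds : ∀ {P b} → ¬ UpperBound P b → ¬ ¬ (∃[ x ] (P x × b < x))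
  not-bound⇒¬¬exceeds {P} {b} ¬ub none = ¬ub λ x px → ≮⇒≥ λ b<x → none (x , px , b<x)

  ·≈* : ∀ n x → n · x ≈ (n · 1#) * x
  ·≈* n x = sym (trans (Mult.×-assoc-* n 1# x) (Mult.×-congʳ n (*-identityˡ x)))

  ·1-nonneg : ∀ n → 0# ≤ n · 1#
  ·1-nonneg zero    = ≤-refl
  ·1-nonneg (suc n) = +-nonneg 0≤1 (·1-nonneg n)

  ·1-mono-≤ : ∀ {m n} → m ℕ.≤ n → m · 1# ≤ n · 1#
  ·1-mono-≤ {n = n} z≤n = ·1-nonneg n
  ·1-mono-≤ (s≤s m≤n)     = +-mono-≤ ≤-refl (·1-mono-≤ m≤n)

  sum : ∀ {A : Set} → List A → (A → ℝ) → ℝ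
  sum xs f = foldr _+_ 0# (map f xs)

  module _ {A : Set} where

    sum-cong-∈ : ∀ (xs : List A) {f g : A → ℝ} → (∀ x → x ∈ xs → f x ≈ g x) → sum xs f ≈ sum xs g
    sum-cong-∈ []       eq = refl
    sum-cong-∈ (x ∷ xs) eq = +-cong (eq x (here ≡.refl)) (sum-cong-∈ xs (λ y → eq y ∘ there))

    sum-cong : ∀ (xs : List A) {f g : A → ℝ} → (∀ x → f x ≈ g x) → sum xs f ≈ sum xs g
    sum-cong xs eq = sum-cong-∈ xs (λ x _ → eq x)

    sum-mono-≤ : ∀ (xs : List A) {f g : A → ℝ} → (∀ x → f x ≤ g x) → sum xs f ≤ sum xs g
    sum-mono-≤ []       le = ≤-refl
    sum-mono-≤ (x ∷ xs) le = +-mono-≤ (le x) (sum-mono-≤ xs le)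

    sum-zero : ∀ (xs : List A) {f : A → ℝ} → (∀ x → f x ≈ 0#) → sum xs f ≈ 0#
    sum-zero []       eq = refl
    sum-zero (x ∷ xs) eq = trans (+-cong (eq x) (sum-zero xs eq)) (+-identityˡ 0#)

    sum-nonneg : ∀ (xs : List A) {f : A → ℝ} → (∀ x → 0# ≤ f x) → 0# ≤ sum xs f
    sum-nonneg []       le = ≤-refl
    sum-nonneg (x ∷ xs) le = +-nonneg (le x) (sum-nonneg xs le)

    sum-+ : ∀ (xs : List A) (f g : A → ℝ) → sum xs (λ x → f x + g x) ≈ sum xs f + sum xs g
    sum-+ []       f g = sym (+-identityˡ 0#)
    sum-+ (x ∷ xs) f g = trans (+-congˡ (sum-+ xs f g)) (RingSolver.interchange _ _ _ _)

    sum-*ˡ : ∀ (xs : List A) c (f : A → ℝ) → sum xs (λ x → c * f x) ≈ c * sum xs f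
    sum-*ˡ []       c f = sym (zeroʳ c)
    sum-*ˡ (x ∷ xs) c f = trans (+-congˡ (sum-*ˡ xs c f)) (sym (distribˡ _ _ _))

    sum-*ʳ : ∀ (xs : List A) c (f : A → ℝ) → sum xs (λ x → f x * c) ≈ sum xs f * c
    sum-*ʳ xs c f = trans (sum-cong xs (λ x → *-comm (f x) c)) (trans (sum-*ˡ xs c f) (*-comm c _))

    term-≤-sum : ∀ {xs : List A} {f : A → ℝ} → (∀ x → 0# ≤ f x) → ∀ {x} → x ∈ xs → f x ≤ sum xs f
    term-≤-sum {y ∷ xs} {f} le (here ≡.refl) =
      certify (sum xs f) (sum-nonneg xs le) refl
    term-≤-sum {y ∷ xs} {f} le {x} (there x∈xs) = begin
      f x           ≈⟨ +-identityˡ _ ⟨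
      0# + f x      ≤⟨ +-mono-≤ (le y) (term-≤-sum le x∈xs) ⟩
      sum (y ∷ xs) f ∎
      where open ≤-Reasoning

    sum-single : ∀ {xs : List A} {f : A → ℝ} {y} → Unique xs → y ∈ xs →
                 (∀ x → x ≢ y → f x ≈ 0#) → sum xs f ≈ f y
    sum-single {x ∷ xs} (x≢ ∷ _) (here ≡.refl) off = trans
      (+-congˡ (trans (sum-cong-∈ xs λ z z∈ → off z (≡.≢-sym (All.lookup x≢ z∈))) (sum-zero xs λ _ → refl)))
      (+-identityʳ _)
    sum-single {x ∷ xs} (x≢ ∷ u) (there y∈xs) off = trans
      (+-cong (off x (All.lookup x≢ y∈xs)) (sum-single u y∈xs off))
      (+-identityˡ _)

  sum-swap : ∀ {A B : Set} (xs : List A) (ys : List B) (f : A → B → ℝ) →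
             sum xs (λ x → sum ys (f x)) ≈ sum ys (λ y → sum xs (λ x → f x y))
  sum-swap []       ys f = sym (sum-zero ys λ _ → refl)
  sum-swap (x ∷ xs) ys f = trans (+-congˡ (sum-swap xs ys f)) (sym (sum-+ ys _ _))

  𝟙 : ∀ {P : Set} → Dec P → ℝ
  𝟙 d = if ⌊ d ⌋ then 1# else 0#

  𝟙-yes : ∀ {P : Set} (d : Dec P) → P → 𝟙 d ≈ 1#
  𝟙-yes (yes _) _ = refl
  𝟙-yes (no ¬p) p = contradiction p ¬p

  𝟙-no : ∀ {P : Set} (d : Dec P) → ¬ P → 𝟙 d ≈ 0#
  𝟙-no (yes p) ¬p = contradiction p ¬p
  𝟙-no (no _)  _  = refl

  𝟙-nonneg : ∀ {P : Set} (d : Dec P) → 0# ≤ 𝟙 d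
  𝟙-nonneg (yes _) = 0≤1
  𝟙-nonneg (no _)  = ≤-refl

  module _ (H : FiniteGraph) where
    open FiniteGraph H renaming (_≟_ to _≟ᵛ_)

    ∑ : (V → ℝ) → ℝ
    ∑ = sum vertices

    ∑-single : ∀ {f : V → ℝ} y → (∀ x → x ≢ y → f x ≈ 0#) → ∑ f ≈ f y
    ∑-single y = sum-single unique (complete y)

    ∑-delta : ∀ (f : V → ℝ) y → ∑ (λ x → 𝟙 (x ≟ᵛ y) * f x) ≈ f y
    ∑-delta f y = trans
      (∑-single y λ x x≢y → trans (*-congʳ (𝟙-no (x ≟ᵛ y) x≢y)) (zeroˡ _))
      (trans (*-congʳ (𝟙-yes (y ≟ᵛ y) ≡.refl)) (*-identityˡ _))

-- Couplings and the limit defining the curvature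

module CouplingCost (ℛ : CompleteOrderedField) (G : FiniteGraph) (D : GraphDistance G) where
  open OrderedField ℛ
  open FiniteGraph G renaming (_≟_ to _≟ᵛ_)
  open GraphDistance D
  private module C = Curvature ℛ G
  open C using (Coupling)

  dist : V → V → ℝ
  dist x y = d x y · 1#

  dist-nonneg : ∀ x y → 0# ≤ dist x y
  dist-nonneg x y = ·1-nonneg (d x y)

  dist-adjacent : ∀ {x y} → T (adj x y) → dist x y ≈ 1#
  dist-adjacent {x} {y} xy = trans (Mult.×-congˡ {x = 1#} d≡1) (+-identityʳ 1#)
    where
    d≡1 : d x y ≡ 1
    d≡1 with d x y | attained x y | minimal x y 1 (step xy nil)
    ... | zero        | nil | _             = contradiction xy (adj-irr x)
    ... | suc zero    | _   | _             = ≡.refl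
    ... | suc (suc _) | _   | s≤s ()

  totalCost : (V → V → ℝ) → ℝ
  totalCost π = ∑ G λ x → ∑ G λ y → dist x y * π x y

  -- With the n-fold sums turned into products by `dist`, the cost is visibly linear in the
  -- coupling.
  cost≈ : ∀ {μ ν} (c : Coupling μ ν) → C.cost D c ≈ totalCost (Coupling.π c)
  cost≈ c = sum-cong vertices λ x → sum-cong vertices λ y → ·≈* (d x y) _

  module _ {μ ν : V → ℝ} (c : Coupling μ ν) where
    open Coupling c

    totalCost-nonneg : 0# ≤ totalCost π
    totalCost-nonneg = sum-nonneg vertices λ x → sum-nonneg vertices λ y →
      *-nonneg (dist-nonneg x y) (nonneg x y)

    π≤marginalˡ : ∀ x y → π x y ≤ μ x
    π≤marginalˡ x y = ≤-trans (term-≤-sum (nonneg x) (complete y)) (≤-reflexive (marginalˡ x))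

    π≤marginalʳ : ∀ x y → π x y ≤ ν y
    π≤marginalʳ x y =
      ≤-trans (term-≤-sum (λ x → nonneg x y) (complete x)) (≤-reflexive (marginalʳ y))

  -- Completeness alone produces the value: costs are nonnegative, and the given coupling makes
  -- their set inhabited.
  W₁-exists : ∀ {μ ν} → Coupling μ ν → ∃ (C.IsW₁ D μ ν)
  W₁-exists {μ} {ν} c = inf-exists _ (λ x≈y (c , eq) → c , trans (sym x≈y) eq)
    (_ , c , refl)
    (0# , λ r (c , eq) → ≤-trans (totalCost-nonneg c) (≤-reflexive (sym (trans eq (cost≈ c)))))

  W₁≤totalCost : ∀ {μ ν r} → C.IsW₁ D μ ν r → (c : Coupling μ ν) → r ≤ totalCost (Coupling.π c)
  W₁≤totalCost (lower , _) c = ≤-trans (lower _ (c , refl)) (≤-reflexive (cost≈ c))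

  W₁-greatest : ∀ {μ ν r} b → C.IsW₁ D μ ν r →
                (∀ (c : Coupling μ ν) → b ≤ totalCost (Coupling.π c)) → b ≤ r
  W₁-greatest b (_ , greatest) le = greatest b λ x (c , eq) →
    ≤-trans (le c) (≤-reflexive (sym (trans eq (cost≈ c))))

  totalCost-+ : ∀ (π π′ : V → V → ℝ) → totalCost (λ x y → π x y + π′ x y) ≈ totalCost π + totalCost π′
  totalCost-+ π π′ = trans
    (sum-cong vertices λ x → trans (sum-cong vertices λ y → distribˡ _ _ _)
      (sum-+ vertices (λ y → dist x y * π x y) (λ y → dist x y * π′ x y)))
    (sum-+ vertices (λ x → ∑ G λ y → dist x y * π x y) (λ x → ∑ G λ y → dist x y * π′ x y))

  totalCost-* : ∀ a (π : V → V → ℝ) → totalCost (λ x y → a * π x y) ≈ a * totalCost π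
  totalCost-* a π = trans
    (sum-cong vertices λ x → trans
      (sum-cong vertices λ y → solve 3 (λ d a p → d :* (a :* p) := a :* (d :* p)) refl (dist x y) a (π x y))
      (sum-*ˡ vertices a (λ y → dist x y * π x y)))
    (sum-*ˡ vertices a (λ x → ∑ G λ y → dist x y * π x y))

  δ : V → V → ℝ
  δ x z = 𝟙 (z ≟ᵛ x)

  δ-same : ∀ x → δ x x ≈ 1#
  δ-same x = 𝟙-yes (x ≟ᵛ x) ≡.refl

  δ-other : ∀ {x z} → z ≢ x → δ x z ≈ 0#
  δ-other {x} {z} = 𝟙-no (z ≟ᵛ x)

  ∑-δ : ∀ x → ∑ G (δ x) ≈ 1#
  ∑-δ x = trans (∑-single G x λ _ → δ-other) (δ-same x)

  totalCost-δʳ : ∀ (f : V → ℝ) y → totalCost (λ u v → f u * δ y v) ≈ ∑ G λ u → dist u y * f u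
  totalCost-δʳ f y = sum-cong vertices λ u → trans
    (sum-cong vertices λ v → solve 3 (λ d f e → d :* (f :* e) := e :* (d :* f)) refl (dist u v) (f u) (δ y v))
    (∑-delta G (λ v → dist u v * f u) y)

  totalCost-δˡ : ∀ (f : V → ℝ) x → totalCost (λ u v → δ x u * f v) ≈ ∑ G λ v → dist x v * f v
  totalCost-δˡ f x = trans
    (sum-cong vertices λ u → trans
      (sum-cong vertices λ v → solve 3 (λ d e f → d :* (e :* f) := e :* (d :* f)) refl (dist u v) (δ x u) (f v))
      (sum-*ˡ vertices (δ x u) (λ v → dist u v * f v)))
    (∑-delta G (λ u → ∑ G λ v → dist u v * f v) x)

  totalCost-δδ : ∀ x y → totalCost (λ u v → δ x u * δ y v) ≈ dist x y
  totalCost-δδ x y = trans (totalCost-δˡ (δ y) x)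
    (trans (sum-cong vertices λ v → *-comm (dist x v) (δ y v)) (∑-delta G (dist x) y))

module LazyWalk (ℛ : CompleteOrderedField) (G : FiniteGraph) (D : GraphDistance G)
                (weight : Curvature.Weight ℛ G) where
  open OrderedField ℛ
  open FiniteGraph G renaming (_≟_ to _≟ᵛ_)
  open GraphDistance D
  open CouplingCost ℛ G D
  open Curvature.Weight weight
  private module C = Curvature ℛ G
  open C using (Coupling)

  w-nonneg : ∀ x y → 0# ≤ w x y
  w-nonneg x y with T? (adj x y)
  ... | yes xy = proj₁ (positive x y xy)
  ... | no ¬xy = ≤-reflexive (sym (off-edge x y ¬xy))

  deg-nonneg : ∀ x → 0# ≤ deg x
  deg-nonneg x = sum-nonneg vertices (w-nonneg x)

  w≤deg : ∀ x y → w x y ≤ deg x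
  w≤deg x y = term-≤-sum (w-nonneg x) (complete y)

  deg-positive : ∀ {x y} → T (adj x y) → 0# < deg x
  deg-positive {x} {y} xy = <-≤-trans (positive x y xy) (w≤deg x y)

  p : V → V → ℝ
  p x z = w x z * deg x ⁻¹

  p-off-edge : ∀ {x z} → ¬ T (adj x z) → p x z ≈ 0#
  p-off-edge {x} {z} ¬xz = trans (*-congʳ (off-edge x z ¬xz)) (zeroˡ _)

  -- There are no loops, so `p x x` vanishes and the definition by cases becomes the mixture α δ_x +
  -- (1 - α) p_x. Convexity in α and compatibility with kernels both rest on this form.
  μ≈ : ∀ α x z → μ α x z ≈ α * δ x z + (1# - α) * p x z
  μ≈ α x z with z ≟ᵛ x | adj x z in eq
  ... | yes ≡.refl | _     = sym (trans (+-cong (*-identityʳ α)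
    (trans (*-congˡ (p-off-edge (adj-irr x))) (zeroʳ _))) (+-identityʳ α))
  ... | no _       | true  = sym (trans (+-congʳ (zeroʳ α)) (+-identityˡ _))
  ... | no _       | false = sym (trans (+-cong (zeroʳ α)
    (trans (*-congˡ (p-off-edge λ t → ≡.subst T eq t)) (zeroʳ _))) (+-identityˡ 0#))

  module _ {x₁} {x} (xx₁ : T (adj x x₁)) where

    p-nonneg : ∀ z → 0# ≤ p x z
    p-nonneg z = *-nonneg (w-nonneg x z) (proj₁ (⁻¹-positive (deg-positive xx₁)))

    ∑-p : ∑ G (p x) ≈ 1#
    ∑-p = trans (sum-*ʳ vertices _ _) (⁻¹-inverseʳ (deg-positive xx₁))

    μ-nonneg : ∀ {α} → 0# ≤ α → α ≤ 1# → ∀ z → 0# ≤ μ α x z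
    μ-nonneg {α} 0≤α α≤1 z = ≤-trans
      (+-nonneg (*-nonneg 0≤α (𝟙-nonneg (z ≟ᵛ x))) (*-nonneg (≤⇒0≤- α≤1) (p-nonneg z)))
      (≤-reflexive (sym (μ≈ α x z)))

    ∑-μ : ∀ α → ∑ G (μ α x) ≈ 1#
    ∑-μ α = begin-equality
      ∑ G (μ α x)                                    ≈⟨ sum-cong vertices (μ≈ α x) ⟩
      ∑ G (λ z → α * δ x z + (1# - α) * p x z)       ≈⟨ sum-+ vertices _ _ ⟩
      ∑ G (λ z → α * δ x z) + ∑ G (λ z → (1# - α) * p x z)
        ≈⟨ +-cong (trans (sum-*ˡ vertices _ _) (*-congˡ (∑-δ x))) (trans (sum-*ˡ vertices _ _) (*-congˡ ∑-p)) ⟩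
      α * 1# + (1# - α) * 1#
        ≈⟨ solve 1 (λ a → a :* :1 :+ (:1 :- a) :* :1 := :1) refl α ⟩
      1#                                             ∎
      where open ≤-Reasoning

  module Edge (x y : V) (xy : T (adj x y)) where
    private yx = adj-sym x y xy

    dist≈1 : dist x y ≈ 1#
    dist≈1 = dist-adjacent xy

    IsW : ℝ → ℝ → Set
    IsW α = C.IsW₁ D (μ α x) (μ α y)

    -- The independent coupling of the two probability measures makes the set of costs inhabited.
    W-exists : ∀ {α} → 0# ≤ α → α < 1# → ∃ (IsW α)
    W-exists {α} 0≤α (α≤1 , _) = W₁-exists record
      { π         = λ u v → μ α x u * μ α y v
      ; nonneg    = λ u v → *-nonneg (μ-nonneg xy 0≤α α≤1 u) (μ-nonneg yx 0≤α α≤1 v)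
      ; marginalˡ = λ u → trans (sum-*ˡ vertices _ _) (trans (*-congˡ (∑-μ yx α)) (*-identityʳ _))
      ; marginalʳ = λ v → trans (sum-*ʳ vertices _ _) (trans (*-congʳ (∑-μ xy α)) (*-identityˡ _))
      }

    -- Only the mass 1 - α that arrives in y from elsewhere can relieve the mass leaving x.
    W-lower : ∀ {α r} → 0# ≤ α → α < 1# → IsW α r → 1# - (1# + 1#) * (1# - α) ≤ r
    W-lower {α} 0≤α α<1 isW = W₁-greatest _ isW λ c → let open Coupling c in begin
      1# - (1# + 1#) * (1# - α)
        ≈⟨ solve 1 (λ a → :1 :- (:1 :+ :1) :* (:1 :- a) := (a :- (:1 :- a))) refl α ⟩
      α - (1# - α)
        ≤⟨ +-monoˡ-≤ _ (α≤ c) ⟩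
      π x y + (1# - α) - (1# - α)
        ≈⟨ solve 2 (λ q a → q :+ a :- a := q) refl (π x y) (1# - α) ⟩
      π x y
        ≈⟨ trans (*-congʳ dist≈1) (*-identityˡ _) ⟨
      dist x y * π x y
        ≤⟨ term-≤-sum (λ v → *-nonneg (dist-nonneg x v) (nonneg x v)) (complete y) ⟩
      ∑ G (λ v → dist x v * π x v)
        ≤⟨ term-≤-sum (λ u → sum-nonneg vertices λ v → *-nonneg (dist-nonneg u v) (nonneg u v)) (complete x) ⟩
      totalCost π ∎
      where
      open ≤-Reasoning
      0≤1-α = ≤⇒0≤- (proj₁ α<1)
      α≤ : (c : Coupling (μ α x) (μ α y)) → α ≤ Coupling.π c x y + (1# - α)
      α≤ c = begin
        α                           ≈⟨ trans (+-cong (*-congˡ (δ-same x)) (*-congˡ (p-off-edge (adj-irr x))))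
                                             (solve 1 (λ a → a :* :1 :+ (:1 :- a) :* :0 := a) refl α) ⟨
        α * δ x x + (1# - α) * p x x ≈⟨ μ≈ α x x ⟨
        μ α x x                     ≈⟨ marginalˡ x ⟨
        ∑ G (π x)                   ≤⟨ sum-mono-≤ vertices bound ⟩
        ∑ G (λ v → π x y * δ y v + (1# - α) * p y v)
                                    ≈⟨ sum-+ vertices _ _ ⟩
        ∑ G (λ v → π x y * δ y v) + ∑ G (λ v → (1# - α) * p y v)
                                    ≈⟨ +-cong (trans (sum-*ˡ vertices _ _) (*-congˡ (∑-δ y)))
                                              (trans (sum-*ˡ vertices _ _) (*-congˡ (∑-p yx))) ⟩
        π x y * 1# + (1# - α) * 1#  ≈⟨ +-cong (*-identityʳ _) (*-identityʳ _) ⟩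
        π x y + (1# - α)            ∎
        where
        open Coupling c
        -- In row `x` of the coupling only column `y` is kept as it is; every other column is capped
        -- by the mass that the walk at `y` sends there, at most 1 - α in all.
        bound : ∀ v → π x v ≤ π x y * δ y v + (1# - α) * p y v
        bound v with v ≟ᵛ y
        ... | yes ≡.refl = certify _ (*-nonneg 0≤1-α (p-nonneg yx v)) (+-congʳ (*-identityʳ _))
        ... | no v≢y     = begin
          π x v                          ≤⟨ π≤marginalʳ c x v ⟩
          μ α y v                        ≈⟨ μ≈ α y v ⟩
          α * δ y v + (1# - α) * p y v
            ≈⟨ +-congʳ (trans (*-congˡ (δ-other v≢y)) (trans (zeroʳ _) (sym (zeroʳ _)))) ⟩
          π x y * 0# + (1# - α) * p y v  ∎

    -- The walk of laziness β is a mixture of the walk of laziness α with standing still.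
    W-convex : ∀ {α β t r s} → 0# < t → t ≤ 1# → 1# - β ≈ t * (1# - α) →
               IsW α r → IsW β s → s ≤ t * r + (1# - t)
    W-convex {α} {β} {t} {r} {s} 0<t t≤1 eq isWα isWβ = begin
      s
        ≈⟨ solve 2 (λ s t → s := (s :- (:1 :- t)) :+ (:1 :- t)) refl s t ⟩
      (s - (1# - t)) + (1# - t)                ≈⟨ +-congʳ (trans (*-congʳ (⁻¹-inverseʳ 0<t)) (*-identityˡ _)) ⟨
      (t * t ⁻¹) * (s - (1# - t)) + (1# - t)   ≈⟨ +-congʳ (*-assoc _ _ _) ⟩
      t * (t ⁻¹ * (s - (1# - t))) + (1# - t)
        ≤⟨ +-monoˡ-≤ _ (*-monoˡ-≤ (proj₁ 0<t) (W₁-greatest _ isWα bound)) ⟩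
      t * r + (1# - t)                         ∎
      where
      open ≤-Reasoning
      0≤1-t = ≤⇒0≤- t≤1
      lazier : ∀ z v → t * μ α z v + (1# - t) * δ z v ≈ μ β z v
      lazier z v = begin-equality
        t * μ α z v + (1# - t) * δ z v
          ≈⟨ +-congʳ (*-congˡ (μ≈ α z v)) ⟩
        t * (α * δ z v + (1# - α) * p z v) + (1# - t) * δ z v
          ≈⟨ solve 4 (λ t a d q → t :* (a :* d :+ (:1 :- a) :* q) :+ (:1 :- t) :* d
                                := (:1 :- t :* (:1 :- a)) :* d :+ t :* (:1 :- a) :* q)
                                    refl t α (δ z v) (p z v) ⟩
        (1# - t * (1# - α)) * δ z v + t * (1# - α) * p z v
          ≈⟨ +-cong (*-congʳ (+-congˡ (-‿cong eq))) (*-congʳ eq) ⟨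
        (1# - (1# - β)) * δ z v + (1# - β) * p z v
          ≈⟨ +-congʳ (*-congʳ (solve 1 (λ b → :1 :- (:1 :- b) := b) refl β)) ⟩
        β * δ z v + (1# - β) * p z v
          ≈⟨ μ≈ β z v ⟨
        μ β z v ∎
      mixture : Coupling (μ α x) (μ α y) → Coupling (μ β x) (μ β y)
      mixture c = record
        { π         = λ u v → t * π u v + (1# - t) * (δ x u * δ y v)
        ; nonneg    = λ u v → +-nonneg (*-nonneg (proj₁ 0<t) (nonneg u v))
                        (*-nonneg 0≤1-t (*-nonneg (𝟙-nonneg (u ≟ᵛ x)) (𝟙-nonneg (v ≟ᵛ y))))
        ; marginalˡ = λ u → trans (sum-+ vertices (λ v → t * π u v) (λ v → (1# - t) * (δ x u * δ y v))) (trans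
            (+-cong (trans (sum-*ˡ vertices t (π u)) (*-congˡ (marginalˡ u)))
              (trans (sum-*ˡ vertices (1# - t) (λ v → δ x u * δ y v)) (*-congˡ
                (trans (sum-*ˡ vertices (δ x u) (δ y)) (trans (*-congˡ (∑-δ y)) (*-identityʳ _))))))
            (lazier x u))
        ; marginalʳ = λ v → trans (sum-+ vertices (λ u → t * π u v) (λ u → (1# - t) * (δ x u * δ y v))) (trans
            (+-cong (trans (sum-*ˡ vertices t (λ u → π u v)) (*-congˡ (marginalʳ v)))
              (trans (sum-*ˡ vertices (1# - t) (λ u → δ x u * δ y v)) (*-congˡ
                (trans (sum-*ʳ vertices (δ y v) (δ x)) (trans (*-congʳ (∑-δ x)) (*-identityˡ _))))))
            (lazier y v))
        }
        where open Coupling c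
      -- The inequality s ≤ t · cost + (1 - t) solved for the cost, because the infimum `r` can only
      -- be compared with bounds that do not mention the coupling.
      bound : ∀ c → t ⁻¹ * (s - (1# - t)) ≤ totalCost (Coupling.π c)
      bound c = begin
        t ⁻¹ * (s - (1# - t))
          ≤⟨ *-monoˡ-≤ (proj₁ (⁻¹-positive 0<t)) (+-monoˡ-≤ _ (W₁≤totalCost isWβ (mixture c))) ⟩
        t ⁻¹ * (totalCost (Coupling.π (mixture c)) - (1# - t))
          ≈⟨ *-congˡ (+-congʳ (trans (totalCost-+ _ _) (+-cong (totalCost-* t π)
               (trans (totalCost-* (1# - t) _) (*-congˡ (trans (totalCost-δδ x y) dist≈1)))))) ⟩
        t ⁻¹ * (t * totalCost π + (1# - t) * 1# - (1# - t))
          ≈⟨ solve 3 (λ i t q → i :* (t :* q :+ (:1 :- t) :* :1 :- (:1 :- t)) := (i :* t) :* q)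
              refl (t ⁻¹) t (totalCost π) ⟩
        (t ⁻¹ * t) * totalCost π
          ≈⟨ trans (*-congʳ (⁻¹-inverseˡ 0<t)) (*-identityˡ _) ⟩
        totalCost π ∎
        where open Coupling c

    κ/ : ℝ → ℝ → ℝ
    κ/ α r = (1# - r) * (1# - α) ⁻¹

    -- For t = (1 - β) / (1 - α) convexity gives 1 - s ≥ t (1 - r); dividing by 1 - β is the claim.
    κ/-mono : ∀ {α β r s} → 0# ≤ α → α ≤ β → β < 1# → IsW α r → IsW β s → κ/ α r ≤ κ/ β s
    κ/-mono {α} {β} {r} {s} 0≤α α≤β β<1 isWα isWβ = begin
      (1# - r) * a ⁻¹                ≈⟨ trans (*-congˡ (⁻¹-inverseʳ 0<b)) (*-identityʳ _) ⟨
      (1# - r) * a ⁻¹ * (b * b ⁻¹)   ≈⟨ solve 4 (λ r i b j → (:1 :- r) :* i :* (b :* j)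
                                                  := (:1 :- (b :* i :* r :+ (:1 :- b :* i))) :* j)
                                                      refl r (a ⁻¹) b (b ⁻¹) ⟩
      (1# - (t * r + (1# - t))) * b ⁻¹
        ≤⟨ *-monoʳ-≤ (proj₁ (⁻¹-positive 0<b))
            (+-mono-≤ ≤-refl (neg-mono-≤ (W-convex 0<t t≤1 (sym ta≈b) isWα isWβ))) ⟩
      (1# - s) * b ⁻¹                ∎
      where
      open ≤-Reasoning
      a = 1# - α
      b = 1# - β
      t = b * a ⁻¹
      0<a = <⇒0<- (≤-<-trans α≤β β<1)
      0<b = <⇒0<- β<1
      0<t = *-positive 0<b (⁻¹-positive 0<a)
      ta≈b : t * a ≈ b
      ta≈b = trans (*-assoc _ _ _) (trans (*-congˡ (⁻¹-inverseˡ 0<a)) (*-identityʳ b))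
      t≤1 : t ≤ 1#
      t≤1 = ≤-trans (*-monoʳ-≤ (proj₁ (⁻¹-positive 0<a)) (+-mono-≤ ≤-refl (neg-mono-≤ α≤β)))
                    (≤-reflexive (⁻¹-inverseʳ 0<a))

    κ/-bounded : ∀ {α r} → 0# ≤ α → α < 1# → IsW α r → κ/ α r ≤ 1# + 1#
    κ/-bounded {α} {r} 0≤α α<1 isW = begin
      (1# - r) * a ⁻¹
        ≤⟨ *-monoʳ-≤ (proj₁ (⁻¹-positive 0<a)) (+-mono-≤ ≤-refl (neg-mono-≤ (W-lower 0≤α α<1 isW))) ⟩
      (1# - (1# - (1# + 1#) * a)) * a ⁻¹
        ≈⟨ solve 2 (λ a i → (:1 :- (:1 :- (:1 :+ :1) :* a)) :* i := (:1 :+ :1) :* (a :* i)) refl a (a ⁻¹) ⟩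
      (1# + 1#) * (a * a ⁻¹)             ≈⟨ trans (*-congˡ (⁻¹-inverseʳ 0<a)) (*-identityʳ _) ⟩
      1# + 1#                            ∎
      where
      open ≤-Reasoning
      a = 1# - α
      0<a = <⇒0<- α<1

    Quotient : ℝ → Set
    Quotient l = ∃[ α ] ∃[ r ] (0# ≤ α × α < 1# × IsW α r × l ≈ κ/ α r)

    quotient-sup : ∃ (IsSup Quotient)
    quotient-sup = sup-exists Quotient
      (_ , 0# , proj₁ W0 , ≤-refl , 0<1 , proj₂ W0 , refl)
      (1# + 1# , λ { _ (α , r , 0≤α , α<1 , isW , eq) → ≤-trans (≤-reflexive eq) (κ/-bounded 0≤α α<1 isW) })
      where W0 = W-exists ≤-refl 0<1

    -- κ_α / (1 - α) increases with α, so the limit is the supremum.  The radius δ of the limit is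
    -- itself a supremum, because a point close to a supremum exists only up to double negation.
    sup⇒κLLY : ∀ {l} → IsSup Quotient l → C.IsκLLY D weight x y l
    sup⇒κLLY {l} (l-upper , l-least) ε 0<ε = radius , 0<radius , λ α 0≤α α<1 1-r<α →
      let r , isW = W-exists 0≤α α<1 in
      1# - r , (r , isW , refl)
      -- Since 1 - α is below the radius, some gap 1 - α′ in `Near` exceeds it. Then α′ ≤ α, and
      -- monotonicity carries the bound from α′ to α.
      , decidable-stable (_ <? _) (λ fails → not-bound⇒¬¬exceeds {Near} {1# - α}
          (λ ub → <⇒≱ (reflect 1-r<α) (radius-least _ ub))
          λ { (δ , inj₁ δ≈0 , 1-α<δ) →
                <⇒≱ 1-α<δ (≤-trans (≤-reflexive δ≈0) (≤⇒0≤- (proj₁ α<1)))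
            ; (δ , inj₂ (α′ , r′ , 0≤α′ , α′<1 , isW′ , near , δ≈) , 1-α<δ) →
                fails (<-≤-trans near (κ/-mono 0≤α′
                    (below (≤-trans (proj₁ 1-α<δ) (≤-reflexive δ≈))) α<1 isW′ isW)) })
      , ≤-<-trans (l-upper _ (α , r , 0≤α , α<1 , isW , refl)) l<l+ε
      where
      l<l+ε : l < l + ε
      l<l+ε = 0<-⇒< (<-≤-trans 0<ε (≤-reflexive (solve 2 (λ l e → e := l :+ e :- l) refl l ε)))
      l-ε<l : l - ε < l
      l-ε<l = 0<-⇒< (<-≤-trans 0<ε (≤-reflexive (solve 2 (λ l e → e := l :- (l :- e)) refl l ε)))
      -- The gaps 1 - α at which the quotient already exceeds l - ε. The point 0 is added so that
      -- the set is inhabited without producing such an α.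
      Near : ℝ → Set
      Near δ = δ ≈ 0# ⊎
        (∃[ α ] ∃[ r ] (0# ≤ α × α < 1# × IsW α r × l - ε < κ/ α r × δ ≈ 1# - α))
      near-sup : ∃ (IsSup Near)
      near-sup = sup-exists Near (0# , inj₁ refl) (1# , λ
        { _ (inj₁ δ≈0) → ≤-trans (≤-reflexive δ≈0) 0≤1
        ; _ (inj₂ (α , _ , 0≤α , _ , _ , _ , δ≈)) → ≤-trans (≤-reflexive δ≈)
            (certify α 0≤α (solve 1 (λ a → :1 := :1 :- a :+ a) refl α)) })
      radius = proj₁ near-sup
      radius-upper = proj₁ (proj₂ near-sup)
      radius-least = proj₂ (proj₂ near-sup)
      0<radius : 0# < radius
      0<radius = ≰⇒> λ radius≤0 → not-bound⇒¬¬exceeds {Quotient} {l - ε}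
        (λ ub → <⇒≱ l-ε<l (l-least _ ub))
        λ { (q , (α , r , 0≤α , α<1 , isW , q≈) , l-ε<q) →
          <⇒≱ (<⇒0<- α<1) (≤-trans
            (radius-upper (1# - α) (inj₂ (α , r , 0≤α , α<1 , isW , <-≤-trans l-ε<q (≤-reflexive q≈) , refl)))
            radius≤0) }
      reflect : ∀ {α} → 1# - radius < α → 1# - α < radius
      reflect {α} q = 0<-⇒< (<-≤-trans (<⇒0<- q)
        (≤-reflexive (solve 2 (λ a r → a :- (:1 :- r) := r :- (:1 :- a)) refl α radius)))
      below : ∀ {α α′} → 1# - α ≤ 1# - α′ → α′ ≤ α
      below {α} {α′} q = certify _ (≤⇒0≤- q)
        (solve 2 (λ a b → a := b :+ (:1 :- b :- (:1 :- a))) refl α α′)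

    -- W₁ ≤ 1 + ε (1 - α) for some α is what nonnegative curvature means before passing to the limit.
    NearlyContracting : Set
    NearlyContracting = ∀ ε → 0# < ε → ∃[ α ] (0# ≤ α × α < 1# × ∃[ r ] (IsW α r × r ≤ 1# + ε * (1# - α)))

    -- One α per ε suffices because the limit is the supremum of the quotients: a negative `l`
    -- leaves room for an ε below - l, whereas the α belonging to that ε has quotient at least - ε.
    contracting⇒κLLY≥0 : NearlyContracting → ∃[ l ] (C.IsκLLY D weight x y l × 0# ≤ l)
    contracting⇒κLLY≥0 h = l , sup⇒κLLY sup , ≮⇒≥ λ l<0 →
      let ε , 0<ε , ε<-l = midpoint (<-≤-trans (<⇒0<- l<0) (≤-reflexive (+-identityˡ _))) in
      <⇒≱ ε<-l (-l≤ ε (h ε 0<ε))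
      where
      open ≤-Reasoning
      l = proj₁ quotient-sup
      sup = proj₂ quotient-sup
      -l≤ : ∀ ε → ∃[ α ] (0# ≤ α × α < 1# × ∃[ r ] (IsW α r × r ≤ 1# + ε * (1# - α))) → - l ≤ ε
      -l≤ ε (α , 0≤α , α<1 , r , isW , r≤) = begin
        - l                             ≤⟨ neg-mono-≤ (proj₁ sup _ (α , r , 0≤α , α<1 , isW , refl)) ⟩
        - ((1# - r) * a ⁻¹)
          ≤⟨ neg-mono-≤ (*-monoʳ-≤ (proj₁ (⁻¹-positive 0<a)) (+-mono-≤ ≤-refl (neg-mono-≤ r≤))) ⟩
        - ((1# - (1# + ε * a)) * a ⁻¹)
          ≈⟨ solve 3 (λ e a i → :- ((:1 :- (:1 :+ e :* a)) :* i) := e :* (a :* i)) refl ε a (a ⁻¹) ⟩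
        ε * (a * a ⁻¹)                  ≈⟨ trans (*-congˡ (⁻¹-inverseʳ 0<a)) (*-identityʳ ε) ⟩
        ε                               ∎
        where
        a = 1# - α
        0<a = <⇒0<- α<1

    -- A quotient within ε of l ≥ 0 is above - ε; multiplying by 1 - α gives the bound on W₁.
    κLLY≥0⇒contracting : ∀ {l} → C.IsκLLY D weight x y l → 0# ≤ l → NearlyContracting
    κLLY≥0⇒contracting {l} isκ 0≤l ε 0<ε with isκ ε 0<ε
    ... | δ , 0<δ , limit with close
      where
      -- Any α in [0,1) above 1 - δ will do: a midpoint when 1 - δ ≥ 0, and 0 itself when δ > 1.
      close : ∃[ α ] (0# ≤ α × α < 1# × 1# - δ < α)
      close with 0# ≤? (1# - δ)
      ... | yes 0≤1-δ = let α , 1-δ<α , α<1 = midpoint 1-δ<1 in α , ≤-trans 0≤1-δ (proj₁ 1-δ<α) , α<1 , 1-δ<α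
        where
        1-δ<1 : 1# - δ < 1#
        1-δ<1 = 0<-⇒< (<-≤-trans 0<δ (≤-reflexive (solve 1 (λ d → d := :1 :- (:1 :- d)) refl δ)))
      ... | no ¬0≤1-δ = 0# , ≤-refl , 0<1 , ≰⇒> ¬0≤1-δ
    ... | α , 0≤α , α<1 , 1-δ<α with limit α 0≤α α<1 1-δ<α
    ... | k , (r , isW , k≈) , l-ε<κ/ , _ = α , 0≤α , α<1 , r , isW
      , certify (1# + ε * (1# - α) - r) (begin
          0#                                         ≤⟨ *-nonneg (≤-trans 0≤l (proj₁ l<κ/+ε)) (proj₁ 0<a) ⟩
          (k * (1# - α) ⁻¹ + ε) * (1# - α)
            ≈⟨ solve 4 (λ k i e a → (k :* i :+ e) :* a := k :* (i :* a) :+ e :* a)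
                refl k ((1# - α) ⁻¹) ε (1# - α) ⟩
          k * ((1# - α) ⁻¹ * (1# - α)) + ε * (1# - α)
            ≈⟨ +-congʳ (trans (*-congˡ (⁻¹-inverseˡ 0<a)) (trans (*-identityʳ k) k≈)) ⟩
          (1# - r) + ε * (1# - α)
            ≈⟨ solve 2 (λ r q → :1 :- r :+ q := :1 :+ q :- r) refl r (ε * (1# - α)) ⟩
          1# + ε * (1# - α) - r                      ∎)
        (solve 2 (λ r q → q := r :+ (q :- r)) refl r (1# + ε * (1# - α)))
      where
      open ≤-Reasoning
      0<a = <⇒0<- α<1
      l<κ/+ε : l < k * (1# - α) ⁻¹ + ε
      l<κ/+ε = 0<-⇒< (<-≤-trans (<⇒0<- l-ε<κ/)
        (≤-reflexive (solve 3 (λ l e q → q :- (l :- e) := q :+ e :- l) refl l ε (k * (1# - α) ⁻¹))))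

    -- At laziness 0 the coupling p_x ⊗ δ_x + δ_y ⊗ p_y - δ_y ⊗ δ_x moves all mass along edges; the
    -- hypothesis, a restatement of w_xy / d_x + w_xy / d_y ≥ 1, makes it nonnegative at (y , x).
    dominant⇒contracting : (deg x - w x y) * (deg y - w x y) ≤ w x y * w x y → NearlyContracting
    dominant⇒contracting dominant ε 0<ε = 0# , ≤-refl , 0<1 , proj₁ W0 , proj₂ W0 , (begin
      proj₁ W0              ≤⟨ W₁≤totalCost (proj₂ W0) coupling ⟩
      totalCost π           ≈⟨ cost≈1 ⟩
      1#                    ≤⟨ certify (ε * (1# - 0#)) (*-nonneg (proj₁ 0<ε) (≤⇒0≤- 0≤1)) refl ⟩
      1# + ε * (1# - 0#)    ∎)
      where
      open ≤-Reasoning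
      W0 = W-exists ≤-refl 0<1
      a = deg x
      b = deg y
      0<a = deg-positive xy
      0<b = deg-positive yx
      1≤p+p : 1# ≤ p x y + p y x
      1≤p+p = certify ((w x y * w x y - (a - w x y) * (b - w x y)) * (a ⁻¹ * b ⁻¹))
        (*-nonneg (≤⇒0≤- dominant) (*-nonneg (proj₁ (⁻¹-positive 0<a)) (proj₁ (⁻¹-positive 0<b))))
        (begin-equality
          p x y + p y x
            ≈⟨ +-cong (*-congʳ refl) (*-congʳ (w-sym y x)) ⟩
          w x y * a ⁻¹ + w x y * b ⁻¹
            ≈⟨ +-cong (trans (*-congˡ (⁻¹-inverseʳ 0<b)) (*-identityʳ _))
                (trans (*-congˡ (⁻¹-inverseʳ 0<a)) (*-identityʳ _)) ⟨
          w x y * a ⁻¹ * (b * b ⁻¹) + w x y * b ⁻¹ * (a * a ⁻¹)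
            ≈⟨ solve 5 (λ w a b i j → w :* i :* (b :* j) :+ w :* j :* (a :* i)
                 := (a :* i) :* (b :* j) :+ (w :* w :- (a :- w) :* (b :- w)) :* (i :* j))
                     refl (w x y) a b (a ⁻¹) (b ⁻¹) ⟩
          (a * a ⁻¹) * (b * b ⁻¹) + (w x y * w x y - (a - w x y) * (b - w x y)) * (a ⁻¹ * b ⁻¹)
            ≈⟨ +-congʳ (trans (*-cong (⁻¹-inverseʳ 0<a) (⁻¹-inverseʳ 0<b)) (*-identityˡ _)) ⟩
          1# + (w x y * w x y - (a - w x y) * (b - w x y)) * (a ⁻¹ * b ⁻¹) ∎)

      π₁ π₂ π₃ π : V → V → ℝ
      π₁ u v = p x u * δ x v
      π₂ u v = δ y u * p y v
      π₃ u v = δ y u * δ x v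
      π u v = (π₁ u v + π₂ u v) + (- 1#) * π₃ u v

      π-nonneg : ∀ u v → 0# ≤ π u v
      π-nonneg u v with u ≟ᵛ y | v ≟ᵛ x
      ... | yes ≡.refl | yes ≡.refl = ≤-trans (≤⇒0≤- 1≤p+p) (≤-reflexive
        (solve 2 (λ p q → p :+ q :- :1 := (p :* :1 :+ :1 :* q) :+ (:- :1) :* (:1 :* :1)) refl (p x y) (p y x)))
      ... | yes ≡.refl | no _ = ≤-trans (p-nonneg yx v) (≤-reflexive
        (solve 2 (λ p q → q := (p :* :0 :+ :1 :* q) :+ (:- :1) :* (:1 :* :0)) refl (p x y) (p y v)))
      ... | no _ | yes ≡.refl = ≤-trans (p-nonneg xy u) (≤-reflexive
        (solve 2 (λ p q → p := (p :* :1 :+ :0 :* q) :+ (:- :1) :* (:0 :* :1)) refl (p x u) (p y x)))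
      ... | no _ | no _ = ≤-reflexive
        (solve 2 (λ p q → :0 := (p :* :0 :+ :0 :* q) :+ (:- :1) :* (:0 :* :0)) refl (p x u) (p y v))

      μ₀ : ∀ z v → μ 0# z v ≈ p z v
      μ₀ z v = trans (μ≈ 0# z v) (solve 2 (λ d q → :0 :* d :+ (:1 :- :0) :* q := q) refl (δ z v) (p z v))

      ∑-factorʳ : ∀ c f → ∑ G f ≈ 1# → ∑ G (λ z → c * f z) ≈ c
      ∑-factorʳ c f eq = trans (sum-*ˡ vertices c f) (trans (*-congˡ eq) (*-identityʳ c))

      ∑-factorˡ : ∀ c f → ∑ G f ≈ 1# → ∑ G (λ z → f z * c) ≈ c
      ∑-factorˡ c f eq = trans (sum-*ʳ vertices c f) (trans (*-congʳ eq) (*-identityˡ c))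

      split : ∀ (f g h : V → ℝ) → ∑ G (λ z → (f z + g z) + (- 1#) * h z) ≈ (∑ G f + ∑ G g) + (- 1#) * ∑ G h
      split f g h = trans (sum-+ vertices (λ z → f z + g z) (λ z → (- 1#) * h z))
        (+-cong (sum-+ vertices f g) (sum-*ˡ vertices (- 1#) h))

      coupling : Coupling (μ 0# x) (μ 0# y)
      coupling = record
        { π         = π
        ; nonneg    = π-nonneg
        ; marginalˡ = λ u → trans (split (π₁ u) (π₂ u) (π₃ u)) (trans
            (+-cong (+-cong (∑-factorʳ (p x u) (δ x) (∑-δ x)) (∑-factorʳ (δ y u) (p y) (∑-p yx)))
                    (*-congˡ (∑-factorʳ (δ y u) (δ x) (∑-δ x))))
            (trans (solve 2 (λ q d → (q :+ d) :+ (:- :1) :* d := q) refl (p x u) (δ y u)) (sym (μ₀ x u))))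
        ; marginalʳ = λ v → trans (split (λ u → π₁ u v) (λ u → π₂ u v) (λ u → π₃ u v)) (trans
            (+-cong (+-cong (∑-factorˡ (δ x v) (p x) (∑-p xy)) (∑-factorˡ (p y v) (δ y) (∑-δ y)))
                    (*-congˡ (∑-factorˡ (δ x v) (δ y) (∑-δ y))))
            (trans (solve 2 (λ q d → (d :+ q) :+ (:- :1) :* d := q) refl (p y v) (δ x v)) (sym (μ₀ y v))))
        }

      unit-stepsˡ : ∑ G (λ u → dist u x * p x u) ≈ 1#
      unit-stepsˡ = trans (sum-cong vertices unit) (∑-p xy)
        where
        unit : ∀ u → dist u x * p x u ≈ p x u
        unit u with T? (adj x u)
        ... | yes xu = trans (*-congʳ (dist-adjacent (adj-sym x u xu))) (*-identityˡ _)
        ... | no ¬xu = trans (*-congˡ (p-off-edge ¬xu)) (trans (zeroʳ _) (sym (p-off-edge ¬xu)))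
      unit-stepsʳ : ∑ G (λ v → dist y v * p y v) ≈ 1#
      unit-stepsʳ = trans (sum-cong vertices unit) (∑-p yx)
        where
        unit : ∀ v → dist y v * p y v ≈ p y v
        unit v with T? (adj y v)
        ... | yes yv = trans (*-congʳ (dist-adjacent yv)) (*-identityˡ _)
        ... | no ¬yv = trans (*-congˡ (p-off-edge ¬yv)) (trans (zeroʳ _) (sym (p-off-edge ¬yv)))

      -- 1 + 1 - 1: each of the two walks makes a unit step, and the mass removed at (y , x) is
      -- credited with the length of the edge.
      cost≈1 : totalCost π ≈ 1#
      cost≈1 = begin-equality
        totalCost π
          ≈⟨ totalCost-+ (λ u v → π₁ u v + π₂ u v) (λ u v → (- 1#) * π₃ u v) ⟩
        totalCost (λ u v → π₁ u v + π₂ u v) + totalCost (λ u v → (- 1#) * π₃ u v)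
          ≈⟨ +-cong (totalCost-+ π₁ π₂) (totalCost-* (- 1#) π₃) ⟩
        (totalCost π₁ + totalCost π₂) + (- 1#) * totalCost π₃
          ≈⟨ +-cong (+-cong (trans (totalCost-δʳ (p x) x) unit-stepsˡ)
              (trans (totalCost-δˡ (p y) y) unit-stepsʳ))
                    (*-congˡ (trans (totalCost-δδ y x) (dist-adjacent yx))) ⟩
        (1# + 1#) + (- 1#) * 1#
          ≈⟨ solve 0 ((:1 :+ :1) :+ (:- :1) :* :1 := :1) refl ⟩
        1# ∎

-- Pushing couplings forward along a Markov kernel

module Transport (ℛ : CompleteOrderedField) {A B : FiniteGraph}
                 (DA : GraphDistance A) (DB : GraphDistance B) where
  open OrderedField ℛ
  private
    module VA = FiniteGraph A
    module VB = FiniteGraph B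
    module CA = CouplingCost ℛ A DA
    module CB = CouplingCost ℛ B DB
  open GraphDistance DA renaming (d to dᴬ) using ()
  open GraphDistance DB renaming (d to dᴮ) using ()

  ∑-product : ∀ c (f g : VB.V → ℝ) → ∑ B f ≈ 1# → ∑ B g ≈ 1# →
              ∑ B (λ b → ∑ B (λ b′ → c * (f b * g b′))) ≈ c
  ∑-product c f g f≈1 g≈1 = begin-equality
    ∑ B (λ b → ∑ B (λ b′ → c * (f b * g b′)))
      ≈⟨ sum-cong VB.vertices (λ b → sum-*ˡ VB.vertices c (λ b′ → f b * g b′)) ⟩
    ∑ B (λ b → c * ∑ B (λ b′ → f b * g b′))
      ≈⟨ sum-*ˡ VB.vertices c (λ b → ∑ B (λ b′ → f b * g b′)) ⟩
    c * ∑ B (λ b → ∑ B (λ b′ → f b * g b′))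
      ≈⟨ *-congˡ (sum-cong VB.vertices λ b → trans (sum-*ˡ VB.vertices (f b) g)
          (trans (*-congˡ g≈1) (*-identityʳ _))) ⟩
    c * ∑ B f
      ≈⟨ trans (*-congˡ f≈1) (*-identityʳ c) ⟩
    c ∎
    where open ≤-Reasoning

  ∑-swap₂ : ∀ (f : VB.V → VB.V → VA.V → VA.V → ℝ) →
            ∑ B (λ b → ∑ B (λ b′ → ∑ A (λ a → ∑ A (λ a′ → f b b′ a a′)))) ≈
            ∑ A (λ a → ∑ A (λ a′ → ∑ B (λ b → ∑ B (λ b′ → f b b′ a a′))))
  ∑-swap₂ f = begin-equality
    ∑ B (λ b → ∑ B (λ b′ → ∑ A (λ a → ∑ A (λ a′ → f b b′ a a′))))
      ≈⟨ sum-cong VB.vertices (λ b → sum-swap VB.vertices VA.vertices (λ b′ a → ∑ A (λ a′ → f b b′ a a′))) ⟩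
    ∑ B (λ b → ∑ A (λ a → ∑ B (λ b′ → ∑ A (λ a′ → f b b′ a a′))))
      ≈⟨ sum-swap VB.vertices VA.vertices (λ b a → ∑ B (λ b′ → ∑ A (λ a′ → f b b′ a a′))) ⟩
    ∑ A (λ a → ∑ B (λ b → ∑ B (λ b′ → ∑ A (λ a′ → f b b′ a a′))))
      ≈⟨ sum-cong VA.vertices (λ a → trans
           (sum-cong VB.vertices (λ b → sum-swap VB.vertices VA.vertices (λ b′ a′ → f b b′ a a′)))
           (sum-swap VB.vertices VA.vertices (λ b a′ → ∑ B (λ b′ → f b b′ a a′)))) ⟩
    ∑ A (λ a → ∑ A (λ a′ → ∑ B (λ b → ∑ B (λ b′ → f b b′ a a′)))) ∎
    where open ≤-Reasoning

  module _ (k : VA.V → VB.V → ℝ) where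

    push : (VA.V → ℝ) → VB.V → ℝ
    push μ b = ∑ A (λ a → μ a * k a b)

    push₂ : (VA.V → VA.V → ℝ) → VB.V → VB.V → ℝ
    push₂ π b b′ = ∑ A (λ a → ∑ A (λ a′ → π a a′ * (k a b * k a′ b′)))

  module _ (k : VA.V → VB.V → ℝ) (k-nonneg : ∀ a b → 0# ≤ k a b) (k-total : ∀ a → ∑ B (k a) ≈ 1#) where

    push-marginal : ∀ (π : VA.V → VA.V → ℝ) {μ} → (∀ a → ∑ A (π a) ≈ μ a) → ∀ b → ∑ B (push₂ k π b) ≈ push k μ b
    push-marginal π {μ} marginal b = begin-equality
      ∑ B (λ b′ → ∑ A (λ a → ∑ A (λ a′ → π a a′ * (k a b * k a′ b′))))
        ≈⟨ trans (sum-swap VB.vertices VA.vertices (λ b′ a → ∑ A (λ a′ → π a a′ * (k a b * k a′ b′))))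
             (sum-cong VA.vertices λ a → sum-swap VB.vertices VA.vertices
                 (λ b′ a′ → π a a′ * (k a b * k a′ b′))) ⟩
      ∑ A (λ a → ∑ A (λ a′ → ∑ B (λ b′ → π a a′ * (k a b * k a′ b′))))
        ≈⟨ sum-cong VA.vertices (λ a → sum-cong VA.vertices λ a′ → trans
             (sum-cong VB.vertices λ b′ → sym (*-assoc (π a a′) (k a b) (k a′ b′)))
             (trans (sum-*ˡ VB.vertices (π a a′ * k a b) (k a′))
                 (trans (*-congˡ (k-total a′)) (*-identityʳ _)))) ⟩
      ∑ A (λ a → ∑ A (λ a′ → π a a′ * k a b))
        ≈⟨ sum-cong VA.vertices (λ a → trans (sum-*ʳ VA.vertices (k a b) (π a)) (*-congʳ (marginal a))) ⟩
      push k μ b ∎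
      where open ≤-Reasoning

    module _ {μ ν : VA.V → ℝ} {μ′ ν′ : VB.V → ℝ} (c : Curvature.Coupling ℛ A μ ν)
             (push-μ : ∀ b → push k μ b ≈ μ′ b) (push-ν : ∀ b → push k ν b ≈ ν′ b) where
      open Curvature.Coupling c

      push-coupling : Curvature.Coupling ℛ B μ′ ν′
      push-coupling = record
        { π         = push₂ k π
        ; nonneg    = λ b b′ → sum-nonneg VA.vertices λ a → sum-nonneg VA.vertices λ a′ →
            *-nonneg (nonneg a a′) (*-nonneg (k-nonneg a b) (k-nonneg a′ b′))
        ; marginalˡ = λ b → trans (push-marginal π marginalˡ b) (push-μ b)
        ; marginalʳ = λ b′ → trans
            (sum-cong VB.vertices λ b → trans (sum-swap VA.vertices VA.vertices
                (λ a a′ → π a a′ * (k a b * k a′ b′)))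
              (sum-cong VA.vertices λ a′ → sum-cong VA.vertices λ a → *-congˡ (*-comm (k a b) (k a′ b′))))
            (trans (push-marginal (λ a′ a → π a a′) marginalʳ b′) (push-ν b′))
        }

      -- Both coordinates move independently by `k`, so only quadruples where π and both kernel
      -- values are nonzero contribute. The exemption for `π a a′ ≈ 0#` depends on the coupling; it
      -- serves the kernel that spreads a pendant vertex over several vertices.
      push-cost : (∀ a a′ b b′ → π a a′ ≈ 0# ⊎ k a b ≈ 0# ⊎ k a′ b′ ≈ 0# ⊎ dᴮ b b′ ℕ.≤ dᴬ a a′) →
                  CB.totalCost (push₂ k π) ≤ CA.totalCost π
      push-cost shorter = begin
        ∑ B (λ b → ∑ B (λ b′ → CB.dist b b′ * push₂ k π b b′))
          ≈⟨ sum-cong VB.vertices (λ b → sum-cong VB.vertices λ b′ → trans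
               (sym (sum-*ˡ VA.vertices (CB.dist b b′) (λ a → ∑ A (λ a′ → π a a′ * (k a b * k a′ b′)))))
               (sum-cong VA.vertices λ a → sym
                   (sum-*ˡ VA.vertices (CB.dist b b′) (λ a′ → π a a′ * (k a b * k a′ b′))))) ⟩
        ∑ B (λ b → ∑ B (λ b′ → ∑ A (λ a → ∑ A (λ a′ → CB.dist b b′ * (π a a′ * (k a b * k a′ b′))))))
          ≤⟨ sum-mono-≤ VB.vertices (λ b → sum-mono-≤ VB.vertices λ b′ → sum-mono-≤ VA.vertices λ a →
               sum-mono-≤ VA.vertices λ a′ →
               termwise a a′ b b′ (shorter a a′ b b′)) ⟩
        ∑ B (λ b → ∑ B (λ b′ → ∑ A (λ a → ∑ A (λ a′ → (CA.dist a a′ * π a a′) * (k a b * k a′ b′)))))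
          ≈⟨ ∑-swap₂ (λ b b′ a a′ → (CA.dist a a′ * π a a′) * (k a b * k a′ b′)) ⟩
        ∑ A (λ a → ∑ A (λ a′ → ∑ B (λ b → ∑ B (λ b′ → (CA.dist a a′ * π a a′) * (k a b * k a′ b′)))))
          ≈⟨ sum-cong VA.vertices (λ a → sum-cong VA.vertices λ a′ →
               ∑-product (CA.dist a a′ * π a a′) (k a) (k a′) (k-total a) (k-total a′)) ⟩
        CA.totalCost π ∎
        where
        open ≤-Reasoning
        vanish : ∀ {x y} → x ≈ 0# → y ≈ 0# → x ≤ y
        vanish p q = ≤-reflexive (trans p (sym q))
        termwise : ∀ a a′ b b′ → π a a′ ≈ 0# ⊎ k a b ≈ 0# ⊎ k a′ b′ ≈ 0# ⊎ dᴮ b b′ ℕ.≤ dᴬ a a′ →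
                   CB.dist b b′ * (π a a′ * (k a b * k a′ b′)) ≤ (CA.dist a a′ * π a a′) * (k a b * k a′ b′)
        termwise a a′ b b′ (inj₁ z) = vanish
          (trans (*-congˡ (trans (*-congʳ z) (zeroˡ _))) (zeroʳ _))
          (trans (*-congʳ (trans (*-congˡ z) (zeroʳ _))) (zeroˡ _))
        termwise a a′ b b′ (inj₂ (inj₁ z)) = vanish
          (trans (*-congˡ (trans (*-congˡ (trans (*-congʳ z) (zeroˡ _))) (zeroʳ _))) (zeroʳ _))
          (trans (*-congˡ (trans (*-congʳ z) (zeroˡ _))) (zeroʳ _))
        termwise a a′ b b′ (inj₂ (inj₂ (inj₁ z))) = vanish
          (trans (*-congˡ (trans (*-congˡ (trans (*-congˡ z) (zeroʳ _))) (zeroʳ _))) (zeroʳ _))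
          (trans (*-congˡ (trans (*-congˡ z) (zeroʳ _))) (zeroʳ _))
        termwise a a′ b b′ (inj₂ (inj₂ (inj₂ d≤d))) = ≤-trans
          (*-monoʳ-≤ (*-nonneg (nonneg a a′) (*-nonneg (k-nonneg a b) (k-nonneg a′ b′))) (·1-mono-≤ d≤d))
          (≤-reflexive (sym (*-assoc _ _ _)))

-- Walks, the distortion number and transport of curvature

module Walks (G : FiniteGraph) where
  open FiniteGraph G

  snoc : ∀ {x y z n} → Walk G x y n → T (adj y z) → Walk G x z (suc n)
  snoc nil           yz = step yz nil
  snoc (step xx₁ xs) yz = step xx₁ (snoc xs yz)

  reverse : ∀ {x y n} → Walk G x y n → Walk G y x n
  reverse nil                   = nil
  reverse (step {x} {y} xy ys)  = snoc (reverse ys) (adj-sym x y xy)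

  walk? : ∀ n x y → Dec (Walk G x y n)
  walk? zero x y = map′ (λ { ≡.refl → nil }) (λ { nil → ≡.refl }) (x ≟ y)
  walk? (suc n) x y = map′
    (λ some → let z , _ , xz , zs = find {P = λ z → T (adj x z) × Walk G z y n} some in step xz zs)
    (λ { (step {y = z} xz zs) → lose (complete z) (xz , zs) })
    (Any.any? (λ z → T? (adj x z) ×-dec walk? n z y) vertices)

  -- Having a walk of a given length is decidable, so lengths are tried upwards from 0. The
  -- invariant `fuel ℕ.+ m ≡ n` leaves the given walk as the answer when the fuel runs out.
  shortest : ∀ {x y} n → Walk G x y n → ∃[ m ] (Walk G x y m × (∀ k → Walk G x y k → m ℕ.≤ k))
  shortest {x} {y} n w = search n 0 (ℕ.+-identityʳ n) (λ k _ → z≤n)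
    where
    search : ∀ fuel m → fuel ℕ.+ m ≡ n → (∀ k → Walk G x y k → m ℕ.≤ k) →
             ∃[ m ] (Walk G x y m × (∀ k → Walk G x y k → m ℕ.≤ k))
    search zero       m ≡.refl least = m , w , least
    search (suc fuel) m eq     least with walk? m x y
    ... | yes v = m , v , least
    ... | no ¬v = search fuel (suc m) (≡.trans (ℕ.+-suc fuel m) eq) λ k v →
      ℕ.≤∧≢⇒< (least k v) λ { ≡.refl → ¬v v }

  graphDistance : Connected G → GraphDistance G
  graphDistance connected = record
    { d        = λ x y → proj₁ (dist x y)
    ; attained = λ x y → proj₁ (proj₂ (dist x y))
    ; minimal  = λ x y n w → proj₂ (proj₂ (dist x y)) n w
    }
    where
    dist = λ x y → shortest _ (proj₂ (connected x y))

module DistortionNumber (ℛ : CompleteOrderedField) (G : FiniteGraph) (edge : HasEdge G) where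
  open OrderedField ℛ
  open FiniteGraph G
  private module C = Curvature ℛ G
  open ≤-Reasoning

  private module _ {A : Set} where
    positive-minimum : (xs : List A) (P : A → Set) (P? : ∀ x → Dec (P x)) (f : A → ℝ) → (∀ x → P x → 0# < f x) →
                       ∃[ m ] (0# < m × (∀ {x} → x ∈ xs → P x → m ≤ f x))
    -- The start value 1 caps the result, which is thus a positive lower bound and not always the
    -- minimum.
    positive-minimum []       P P? f pos = 1# , 0<1 , λ ()
    positive-minimum (y ∷ ys) P P? f pos with positive-minimum ys P P? f pos | P? y
    ... | m , 0<m , le | no ¬py = m , 0<m , λ
      { (here ≡.refl) px → contradiction px ¬py
      ; (there x∈)    px → le x∈ px }
    ... | m , 0<m , le | yes py with total m (f y)
    ... | inj₁ m≤ = m , 0<m , λ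
      { (here ≡.refl) px → m≤
      ; (there x∈)    px → le x∈ px }
    ... | inj₂ f≤ = f y , pos y py , λ
      { (here ≡.refl) px → ≤-refl
      ; (there x∈)    px → ≤-trans f≤ (le x∈ px) }

  module _ (D : GraphDistance G) (weight : C.Weight) where
    open Curvature.Weight weight
    open LazyWalk ℛ G D weight using (w-nonneg; w≤deg; deg-nonneg)

    weights-bounded-below : ∃[ m ] (0# < m × (∀ x y → T (adj x y) → m ≤ w x y))
    weights-bounded-below = let m , 0<m , le = global in
      m , 0<m , λ x y xy → ≤-trans (le (complete x) tt) (proj₂ (proj₂ (row x)) (complete y) xy)
      where
      row = λ x → positive-minimum vertices (λ y → T (adj x y)) (λ y → T? (adj x y)) (w x) (positive x)
      global = positive-minimum vertices (λ _ → T true) (λ _ → yes tt) (proj₁ ∘ row)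
          (λ x _ → proj₁ (proj₂ (row x)))

    -- By finiteness the weights are bounded above by the total degree and below by a positive
    -- constant, so both extrema exist and the infimum is positive. Finite DN is thereby reduced to
    -- the existence of an admissible weight.
    distortion-finite : ∃[ q ] C.IsDist weight (C.fin q)
    distortion-finite =
      let x , y , xy = edge
          some       = _ , x , y , xy , refl
          m , 0<m , m≤ = weights-bounded-below
          s , sup = sup-exists EdgeValue some
            (∑ G deg , λ { _ (x , y , xy , eq) → ≤-trans (≤-reflexive eq)
                (≤-trans (w≤deg x y) (term-≤-sum deg-nonneg (complete x))) })
          m-lower = λ { _ (x , y , xy , eq) → ≤-trans (m≤ x y xy) (≤-reflexive (sym eq)) }
          i , inf = inf-exists EdgeValue (λ eq (x , y , xy , eq′) → x , y , xy , trans (sym eq) eq′) some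
            (m , m-lower)
      in s * i ⁻¹ , s , i , sup , inf , <-≤-trans 0<m (proj₂ inf m m-lower) , refl

    distortion-nonneg : ∀ {q} → C.IsDist weight (C.fin q) → 0# ≤ q
    distortion-nonneg (s , i , (upper , _) , _ , 0<i , q≈) = ≤-trans
      (*-nonneg (≤-trans (proj₁ (positive _ _ (proj₂ (proj₂ edge))))
          (upper _ (_ , _ , proj₂ (proj₂ edge) , refl)))
                (proj₁ (⁻¹-positive 0<i)))
      (≤-reflexive (sym q≈))

  admissible⇒DN<∞ : (D : GraphDistance G) (weight : C.Weight) → C.Admissible D weight → C.DN<∞
  admissible⇒DN<∞ D weight admissible = C.fin (proj₁ inf) , (D , inj₁ (edge , some , proj₂ inf)) , tt
    where
    some : ∃ (C.AdmissibleDist D)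
    some = _ , weight , admissible , proj₂ (distortion-finite D weight)
    inf = inf-exists (C.AdmissibleDist D)
      (λ { eq (v , adm , s , i , sup , inf , 0<i , q≈) →
             v , adm , s , i , sup , inf , 0<i , trans (sym eq) q≈ })
      some
      (0# , λ { _ (v , _ , isDist) → distortion-nonneg D v isDist })

  DN<∞⇒admissible : C.DN<∞ → Σ[ D ∈ GraphDistance G ] ∃ (C.Admissible D)
  DN<∞⇒admissible (C.fin _ , (D , inj₁ (_ , (_ , weight , admissible , _) , _)) , _) = D , weight , admissible
  DN<∞⇒admissible (C.fin _ , (_ , inj₂ (¬edge , _)) , _) = contradiction edge ¬edge

module CurvatureTransport (ℛ : CompleteOrderedField) {G H : FiniteGraph}
                          (DG : GraphDistance G) (DH : GraphDistance H)
                          (wG : Curvature.Weight ℛ G) (wH : Curvature.Weight ℛ H) where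
  open OrderedField ℛ
  open ≤-Reasoning
  private
    module G = FiniteGraph G
    module H = FiniteGraph H
    module CG = CouplingCost ℛ G DG
    module CH = CouplingCost ℛ H DH
    module LG = LazyWalk ℛ G DG wG
    module LH = LazyWalk ℛ H DH wH
    module WG = Curvature.Weight wG
    module WH = Curvature.Weight wH
  open GraphDistance DG renaming (d to dᴳ) using ()
  open GraphDistance DH renaming (d to dᴴ) using ()
  open Transport ℛ DG DH

  module _ (x y : G.V) (x′ y′ : H.V) (xy : T (G.adj x y)) (xy′ : T (H.adj x′ y′))
           (k : G.V → H.V → ℝ) (k-nonneg : ∀ a b → 0# ≤ k a b) (k-total : ∀ a → ∑ H (k a) ≈ 1#)
           (k-x : ∀ b → k x b ≈ CH.δ x′ b) (k-y : ∀ b → k y b ≈ CH.δ y′ b)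
           (push-x : ∀ b → push k (LG.p x) b ≈ LH.p x′ b)
           (push-y : ∀ b → push k (LG.p y) b ≈ LH.p y′ b)
           (shorter : ∀ {α} (c : Curvature.Coupling ℛ G (WG.μ α x) (WG.μ α y)) a a′ b b′ →
              Curvature.Coupling.π c a a′ ≈ 0# ⊎ k a b ≈ 0# ⊎ k a′ b′ ≈ 0# ⊎ dᴴ b b′ ℕ.≤ dᴳ a a′) where
    private
      push-μ : ∀ {z z′} → (∀ b → k z b ≈ CH.δ z′ b) → (∀ b → push k (LG.p z) b ≈ LH.p z′ b) →
               ∀ α b → push k (WG.μ α z) b ≈ WH.μ α z′ b
      push-μ {z} {z′} k-z push-z α b = begin-equality
        ∑ G (λ a → WG.μ α z a * k a b)
          ≈⟨ sum-cong G.vertices (λ a → trans (*-congʳ (LG.μ≈ α z a))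
               (solve 4 (λ α d q k → (α :* d :+ (:1 :- α) :* q) :* k := α :* (d :* k) :+ (:1 :- α) :* (q :* k))
                  refl α (CG.δ z a) (LG.p z a) (k a b))) ⟩
        ∑ G (λ a → α * (CG.δ z a * k a b) + (1# - α) * (LG.p z a * k a b))
          ≈⟨ sum-+ G.vertices (λ a → α * (CG.δ z a * k a b)) (λ a → (1# - α) * (LG.p z a * k a b)) ⟩
        ∑ G (λ a → α * (CG.δ z a * k a b)) + ∑ G (λ a → (1# - α) * (LG.p z a * k a b))
          ≈⟨ +-cong (trans (sum-*ˡ G.vertices α (λ a → CG.δ z a * k a b))
              (*-congˡ (trans (∑-delta G (λ a → k a b) z) (k-z b))))
                    (trans (sum-*ˡ G.vertices (1# - α) (λ a → LG.p z a * k a b)) (*-congˡ (push-z b))) ⟩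
        α * CH.δ z′ b + (1# - α) * LH.p z′ b
          ≈⟨ LH.μ≈ α z′ b ⟨
        WH.μ α z′ b ∎

    -- The kernel sends δ_x to δ_x′ and p_x to p_x′, hence lazy walks to lazy walks of the same
    -- laziness, and likewise at y. W₁ does not increase, so the same α serves on both sides.
    contracting-push : LG.Edge.NearlyContracting x y xy → LH.Edge.NearlyContracting x′ y′ xy′
    contracting-push contracting ε 0<ε =
      let α , 0≤α , α<1 , r , isW , r≤ = contracting ε 0<ε
          s , isW′ = LH.Edge.W-exists x′ y′ xy′ 0≤α α<1
      in α , 0≤α , α<1 , s , isW′ , ≤-trans (W₁-push isW isW′) r≤
      where
      W₁-push : ∀ {α r s} → LG.Edge.IsW x y xy α r → LH.Edge.IsW x′ y′ xy′ α s → s ≤ r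
      W₁-push {α} {r} {s} isW isW′ = CG.W₁-greatest s isW λ c → ≤-trans
        (CH.W₁≤totalCost isW′ (push-coupling k k-nonneg k-total c (push-μ k-x push-x α) (push-μ k-y push-y α)))
        (push-cost k k-nonneg k-total c (push-μ k-x push-x α) (push-μ k-y push-y α) (shorter c))

admissible⇒contracting : ∀ {ℛ G} (D : GraphDistance G) (weight : Curvature.Weight ℛ G) →
  Curvature.Admissible ℛ G D weight →
  ∀ x y (xy : T (FiniteGraph.adj G x y)) → LazyWalk.Edge.NearlyContracting ℛ G D weight x y xy
admissible⇒contracting {ℛ} {G} D weight admissible x y xy =
  let _ , isκ , 0≤l = admissible x y xy in
  LazyWalk.Edge.κLLY≥0⇒contracting ℛ G D weight x y xy isκ 0≤l

contracting⇒admissible : ∀ {ℛ G} (D : GraphDistance G) (weight : Curvature.Weight ℛ G) →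
  (∀ x y (xy : T (FiniteGraph.adj G x y)) → LazyWalk.Edge.NearlyContracting ℛ G D weight x y xy) →
  Curvature.Admissible ℛ G D weight
contracting⇒admissible {ℛ} {G} D weight contracting x y xy =
  LazyWalk.Edge.contracting⇒κLLY≥0 ℛ G D weight x y xy (contracting x y xy)

-- Peeling a graph down to its 2-core

∧⁺ : ∀ a b → T a → T b → T (a ∧ b)
∧⁺ a b p q = Equivalence.from (T-∧ {a} {b}) (p , q)

∧⁻ : ∀ a b → T (a ∧ b) → T a × T b
∧⁻ a b = Equivalence.to (T-∧ {a} {b})

not⁺ : ∀ a → ¬ T a → T (not a)
not⁺ true  ¬t = ¬t tt
not⁺ false _  = tt

not⁻ : ∀ a → T (not a) → ¬ T a
not⁻ false _ ()

module _ {A : Set} where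

  count : (A → Bool) → List A → ℕ
  count p xs = length (filterᵇ p xs)

  count-mono : ∀ {p q : A → Bool} → (∀ x → T (p x) → T (q x)) → ∀ xs → count p xs ℕ.≤ count q xs
  count-mono         p⇒q []       = z≤n
  count-mono {p} {q} p⇒q (x ∷ xs) with p x | q x | p⇒q x
  ... | true  | true  | _ = s≤s (count-mono p⇒q xs)
  ... | true  | false | f = contradiction tt f
  ... | false | true  | _ = ℕ.m≤n⇒m≤1+n (count-mono p⇒q xs)
  ... | false | false | _ = count-mono p⇒q xs

  count-strict : ∀ {p q : A → Bool} → (∀ x → T (p x) → T (q x)) →
                 ∀ {y xs} → y ∈ xs → T (q y) → ¬ T (p y) → count p xs ℕ.< count q xs
  count-strict {p} {q} p⇒q {y} {_ ∷ xs} (here ≡.refl) qy ¬py with p y | q y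
  ... | true  | _    = contradiction tt ¬py
  ... | false | true = s≤s (count-mono p⇒q xs)
  count-strict {p} {q} p⇒q {y} {x ∷ xs} (there y∈xs) qy ¬py with p x | q x | p⇒q x
  ... | true  | true  | _ = s≤s (count-strict p⇒q y∈xs qy ¬py)
  ... | true  | false | f = contradiction tt f
  ... | false | true  | _ = ℕ.m≤n⇒m≤1+n (count-strict p⇒q y∈xs qy ¬py)
  ... | false | false | _ = count-strict p⇒q y∈xs qy ¬py

  count-member : ∀ (p : A → Bool) xs → 1 ℕ.≤ count p xs → ∃[ x ] (x ∈ xs × T (p x))
  count-member p xs 1≤ with filterᵇ p xs in eq
  count-member p xs 1≤ | x ∷ _ = x , ∈-filter⁻ (T? ∘ p) (≡.subst (x ∈_) (≡.sym eq) (here ≡.refl))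

  count≤1⇒unique : ∀ (p : A → Bool) {xs} → count p xs ℕ.≤ 1 →
                   ∀ {x y} → x ∈ xs → T (p x) → y ∈ xs → T (p y) → x ≡ y
  count≤1⇒unique p {xs} ≤1 x∈ px y∈ py =
    short ≤1 (∈-filter⁺ (T? ∘ p) x∈ px) (∈-filter⁺ (T? ∘ p) y∈ py)
    where
    short : ∀ {zs : List A} → length zs ℕ.≤ 1 → ∀ {x y} → x ∈ zs → y ∈ zs → x ≡ y
    short {_ ∷ []} _ (here ≡.refl) (here ≡.refl) = ≡.refl
    short {_ ∷ _ ∷ _} (s≤s ())

module _ {G : FiniteGraph} (K : Subgraph G) where
  open FiniteGraph G
  open Subgraph K

  -- The vertices of S outside K form a forest hanging off K.
  record Hanging (S : V → Bool) : Set where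
    field
      depth        : V → ℕ
      parent       : V → V
      depth-core   : ∀ x → T (vert x) → depth x ≡ 0
      depth-parent : ∀ x → T (S x) → ¬ T (vert x) → depth x ≡ suc (depth (parent x))
      parent-in    : ∀ x → T (S x) → ¬ T (vert x) → T (S (parent x))
      parent-adj   : ∀ x → T (S x) → ¬ T (vert x) → T (adj x (parent x))
      edges        : ∀ x y → T (S x) → T (S y) → T (adj x y) →
                     T (edge x y) ⊎ (¬ T (vert x) × parent x ≡ y) ⊎ (¬ T (vert y) × parent y ≡ x)

  module Peeling (connected : Connected G) (is2Core : Is2Core K) (nonempty : Nonempty) where

    -- A walk to the core through `S`: the remnant of connectedness that survives peeling. It gives
    -- a vertex of `S` outside the core a neighbour in `S`, so a vertex of degree at most 1 has
    -- exactly one, which becomes its parent.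
    data Reach (S : V → Bool) : V → Set where
      core : ∀ {x} → T (vert x) → Reach S x
      next : ∀ {x y} → T (adj x y) → T (S y) → Reach S y → Reach S x

    reach-all : ∀ x → Reach (λ _ → true) x
    reach-all x = along (proj₂ (connected x (proj₁ nonempty)))
      where
      along : ∀ {x n} → Walk G x (proj₁ nonempty) n → Reach (λ _ → true) x
      along nil        = core (proj₂ nonempty)
      along (step e w) = next e tt (along w)

    _∖_ : (V → Bool) → V → V → Bool
    (S ∖ v) x = S x ∧ not ⌊ x ≟ v ⌋

    ∖⁺ : ∀ S v {x} → T (S x) → x ≢ v → T ((S ∖ v) x)
    ∖⁺ S v {x} Sx x≢v = ∧⁺ (S x) _ Sx (fromWitnessFalse {a? = x ≟ v} x≢v)

    ∖⁻ : ∀ S v {x} → T ((S ∖ v) x) → T (S x) × x ≢ v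
    ∖⁻ S v {x} t = let Sx , n = ∧⁻ (S x) _ t in Sx , toWitnessFalse {a? = x ≟ v} n

    induced-edge : (V → Bool) → V → V → Bool
    induced-edge S x y = S x ∧ (S y ∧ adj x y)

    induced-edge⁺ : ∀ S {x y} → T (S x) → T (S y) → T (adj x y) → T (induced-edge S x y)
    induced-edge⁺ S {x} {y} Sx Sy xy = ∧⁺ (S x) _ Sx (∧⁺ (S y) _ Sy xy)

    induced-edge⁻ : ∀ S x y → T (induced-edge S x y) → T (S x) × T (S y) × T (adj x y)
    induced-edge⁻ S x y t = let Sx , t′ = ∧⁻ (S x) _ t in Sx , ∧⁻ (S y) _ t′

    induced : (V → Bool) → Subgraph G
    induced S = record
      { vert      = S
      ; edge      = induced-edge S
      ; edge-sym  = λ x y t → let Sx , Sy , xy = induced-edge⁻ S x y t in induced-edge⁺ S Sy Sx (adj-sym x y xy)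
      ; edge-vert = λ x y t → proj₁ (induced-edge⁻ S x y t)
      ; edge-adj  = λ x y t → proj₂ (proj₂ (induced-edge⁻ S x y t))
      }

    core-induced : ∀ S → (∀ x → T (vert x) → T (S x)) → ∀ x y → T (edge x y) → T (induced-edge S x y)
    core-induced S K⊆S x y xy =
      induced-edge⁺ S (K⊆S x (edge-vert x y xy)) (K⊆S y (edge-vert y x (edge-sym x y xy))) (edge-adj x y xy)

    -- A walk that enters the leaf `v` must leave it to its only neighbour, the vertex it came from;
    -- the detour is cut out.
    reach-∖ : ∀ S {v} → T (S v) → ¬ T (vert v) → count (induced-edge S v) vertices ℕ.≤ 1 →
              ∀ {x} → T (S x) → x ≢ v → Reach S x → Reach (S ∖ v) x
    reach-∖ S Sv v∉K ≤1 Sx x≢v (core x∈K) = core x∈K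
    reach-∖ S {v} Sv v∉K ≤1 {x} Sx x≢v (next {y = y} xy Sy ry) with y ≟ v
    ... | no y≢v = next xy (∖⁺ S v Sy y≢v) (reach-∖ S Sv v∉K ≤1 Sy y≢v ry)
    reach-∖ S Sv v∉K ≤1 Sx x≢v (next xy Sy (core v∈K)) | yes ≡.refl = contradiction v∈K v∉K
    reach-∖ S {v} Sv v∉K ≤1 {x} Sx x≢v (next {y = .v} xv Sy (next {y = z} vz Sz rz)) | yes ≡.refl
      with count≤1⇒unique (induced-edge S v) ≤1 (complete z) (induced-edge⁺ S Sv Sz vz)
             (complete x) (induced-edge⁺ S Sv Sx (adj-sym x v xv))
    ... | ≡.refl = reach-∖ S Sv v∉K ≤1 Sx x≢v rz

    -- Puts the peeled leaf back, one level below its only neighbour. The other vertices keep their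
    -- data, since their parents lie in `S ∖ v` and so differ from `v`.
    extend : ∀ S {v u} → T (S v) → ¬ T (vert v) → T (adj v u) → T (S u) →
             count (induced-edge S v) vertices ℕ.≤ 1 → Hanging (S ∖ v) → Hanging S
    extend S {v} {u} Sv v∉K vu Su ≤1 H = record
      { depth        = depth′
      ; parent       = parent′
      ; depth-core   = λ x x∈K → ≡.trans (depth-old λ { ≡.refl → v∉K x∈K }) (depth-core x x∈K)
      ; depth-parent = depth-parent′
      ; parent-in    = λ x Sx x∉K → proj₁ (parent-ok x Sx x∉K)
      ; parent-adj   = λ x Sx x∉K → proj₂ (parent-ok x Sx x∉K)
      ; edges        = edges′
      }
      where
      open Hanging H
      u≢v : u ≢ v
      u≢v ≡.refl = adj-irr v vu
      depth′ : V → ℕ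
      depth′ x = if ⌊ x ≟ v ⌋ then suc (depth u) else depth x
      parent′ : V → V
      parent′ x = if ⌊ x ≟ v ⌋ then u else parent x
      depth-old : ∀ {x} → x ≢ v → depth′ x ≡ depth x
      depth-old {x} x≢v with x ≟ v
      ... | yes x≡v = contradiction x≡v x≢v
      ... | no  _   = ≡.refl
      depth-new : depth′ v ≡ suc (depth u)
      depth-new with v ≟ v
      ... | yes _  = ≡.refl
      ... | no v≢v = contradiction ≡.refl v≢v
      parent-old : ∀ {x} → x ≢ v → parent′ x ≡ parent x
      parent-old {x} x≢v with x ≟ v
      ... | yes x≡v = contradiction x≡v x≢v
      ... | no  _   = ≡.refl
      parent-new : parent′ v ≡ u
      parent-new with v ≟ v
      ... | yes _  = ≡.refl
      ... | no v≢v = contradiction ≡.refl v≢v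
      parent-ok : ∀ x → T (S x) → ¬ T (vert x) → T (S (parent′ x)) × T (adj x (parent′ x))
      parent-ok x Sx x∉K with x ≟ v
      ... | yes ≡.refl = Su , vu
      ... | no x≢v     = proj₁ (∖⁻ S v (parent-in x (∖⁺ S v Sx x≢v) x∉K)) , parent-adj x (∖⁺ S v Sx x≢v) x∉K
      depth-parent′ : ∀ x → T (S x) → ¬ T (vert x) → depth′ x ≡ suc (depth′ (parent′ x))
      depth-parent′ x Sx x∉K = case x ≟ v of λ
        { (yes ≡.refl) → ≡.trans depth-new (≡.cong suc
            (≡.sym (≡.trans (≡.cong depth′ parent-new) (depth-old u≢v))))
        ; (no x≢v) → let Sx′ = ∖⁺ S v Sx x≢v in
            ≡.trans (depth-old x≢v) (≡.trans (depth-parent x Sx′ x∉K) (≡.cong suc (≡.sym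
              (≡.trans (≡.cong depth′ (parent-old x≢v)) (depth-old (proj₂ (∖⁻ S v (parent-in x Sx′ x∉K)))))))) }
      only-u : ∀ {y} → T (S y) → T (adj v y) → u ≡ y
      only-u Sy vy = count≤1⇒unique (induced-edge S v) ≤1 (complete u) (induced-edge⁺ S Sv Su vu)
                       (complete _) (induced-edge⁺ S Sv Sy vy)
      edges′ : ∀ x y → T (S x) → T (S y) → T (adj x y) →
               T (edge x y) ⊎ (¬ T (vert x) × parent′ x ≡ y) ⊎ (¬ T (vert y) × parent′ y ≡ x)
      edges′ x y Sx Sy xy = case x ≟ v of λ
        { (yes ≡.refl) → inj₂ (inj₁ (v∉K , ≡.trans parent-new (only-u Sy xy)))
        ; (no x≢v) → case y ≟ v of λ
          { (yes ≡.refl) → inj₂ (inj₂ (v∉K , ≡.trans parent-new (only-u Sx (adj-sym x v xy))))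
          ; (no y≢v) → case edges x y (∖⁺ S v Sx x≢v) (∖⁺ S v Sy y≢v) xy of λ
            { (inj₁ e)               → inj₁ e
            ; (inj₂ (inj₁ (x∉K , p))) → inj₂ (inj₁ (x∉K , ≡.trans (parent-old x≢v) p))
            ; (inj₂ (inj₂ (y∉K , p))) → inj₂ (inj₂ (y∉K , ≡.trans (parent-old y≢v) p)) } } }

    -- If no vertex of degree at most 1 is left, the subgraph induced on `S` has minimum degree 2
    -- and contains `K`, so maximality puts it inside `K`. A core vertex never becomes a leaf, as
    -- its core neighbours stay in `S`. The recursion descends on the bound `n` for the size of `S`.
    peel : ∀ n S → count S vertices ℕ.≤ n → (∀ x → T (vert x) → T (S x)) →
           (∀ x → T (S x) → Reach S x) → Hanging S
    peel n S ≤n K⊆S reach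
      with Any.any? (λ v → T? (S v) ×-dec (count (induced-edge S v) vertices ℕ.≤? 1)) vertices
    ... | no none = record
      { depth        = λ _ → 0
      ; parent       = λ x → x
      ; depth-core   = λ _ _ → ≡.refl
      ; depth-parent = λ x Sx x∉K → contradiction (S⊆K x Sx) x∉K
      ; parent-in    = λ x Sx x∉K → contradiction (S⊆K x Sx) x∉K
      ; parent-adj   = λ x Sx x∉K → contradiction (S⊆K x Sx) x∉K
      ; edges        = λ x y Sx Sy xy → inj₁ (proj₂ maximal x y (induced-edge⁺ S Sx Sy xy))
      }
      where
      maximal : induced S ⊑ K
      maximal = proj₂ is2Core (induced S)
        (λ x Sx → ℕ.≰⇒> λ ≤1 → none (lose (complete x) (Sx , ≤1)))
        (K⊆S , core-induced S K⊆S)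
      S⊆K = proj₁ maximal
    ... | yes some with find some
    ... | v , _ , Sv , ≤1 with n
    ... | zero = contradiction
      (ℕ.≤-trans (count-strict {p = λ _ → false} (λ _ ()) (complete v) Sv (λ ())) ≤n) λ ()
    ... | suc n′ = leaf (reach v Sv)
      where
      v∉K : ¬ T (vert v)
      v∉K v∈K = ℕ.<⇒≱ (ℕ.≤-trans (proj₁ is2Core v v∈K) (count-mono (core-induced S K⊆S v) vertices)) ≤1
      leaf : Reach S v → Hanging S
      leaf (core v∈K)      = contradiction v∈K v∉K
      leaf (next vu Su _) = extend S Sv v∉K vu Su ≤1 (peel n′ (S ∖ v)
        (ℕ.≤-pred (ℕ.≤-trans
          (count-strict (λ x t → proj₁ (∖⁻ S v {x} t)) (complete v) Sv (λ t → proj₂ (∖⁻ S v t) ≡.refl)) ≤n))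
        (λ x x∈K → ∖⁺ S v (K⊆S x x∈K) λ { ≡.refl → v∉K x∈K })
        (λ x t → let Sx , x≢v = ∖⁻ S v {x} t in reach-∖ S Sv v∉K ≤1 Sx x≢v (reach x Sx)))

    hanging : Hanging (λ _ → true)
    hanging = peel _ _ ℕ.≤-refl (λ _ _ → tt) (λ x _ → reach-all x)

-- Collapsing the hanging trees

module Retraction {G : FiniteGraph} (K : Subgraph G) (hanging : Hanging K (λ _ → true)) where
  open FiniteGraph G
  open Subgraph K
  open Hanging hanging using (depth; parent; depth-core)

  private
    V̂ = FiniteGraph.V (K̂ K)
    adĵ = FiniteGraph.adj (K̂ K)

  depth-parent : ∀ {x} → ¬ T (vert x) → depth x ≡ suc (depth (parent x))
  depth-parent {x} = Hanging.depth-parent hanging x tt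

  parent-adj : ∀ {x} → ¬ T (vert x) → T (adj x (parent x))
  parent-adj {x} = Hanging.parent-adj hanging x tt

  edges : ∀ {x y} → T (adj x y) → T (edge x y) ⊎ (¬ T (vert x) × parent x ≡ y) ⊎ (¬ T (vert y) × parent y ≡ x)
  edges {x} {y} = Hanging.edges hanging x y tt tt

  edge-vertʳ : ∀ {x y} → T (edge x y) → T (vert y)
  edge-vertʳ {x} {y} xy = edge-vert y x (edge-sym x y xy)

  depth-0 : ∀ {x} → depth x ≡ 0 → T (vert x)
  depth-0 {x} eq with T? (vert x)
  ... | yes x∈K = x∈K
  ... | no x∉K  = contradiction (≡.trans (≡.sym eq) (depth-parent x∉K)) λ ()

  depth-suc : ∀ {x n} → depth x ≡ suc n → ¬ T (vert x)
  depth-suc {x} eq x∈K = contradiction (≡.trans (≡.sym eq) (depth-core x x∈K)) λ ()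

  depth-pred : ∀ {x n} → depth x ≡ suc n → depth (parent x) ≡ n
  depth-pred eq = ℕ.suc-injective (≡.trans (≡.sym (depth-parent (depth-suc eq))) eq)

  climb : ℕ → V → V
  climb zero    x = x
  climb (suc n) x = climb n (parent x)

  root : V → V
  root x = climb (depth x) x

  root-core : ∀ {x} → T (vert x) → root x ≡ x
  root-core {x} x∈K rewrite depth-core x x∈K = ≡.refl

  root-parent : ∀ {x} → ¬ T (vert x) → root x ≡ root (parent x)
  root-parent {x} x∉K rewrite depth-parent x∉K = ≡.refl

  attached : ∀ {x z} → T (vert x) → ¬ T (vert z) → T (adj x z) → T (attachment K x)
  attached {x} {z} x∈K z∉K xz = ∧⁺ (vert x) _ x∈K
    (Any.any⁺ (λ z → adj x z ∧ not (vert z)) (lose (complete z) (∧⁺ (adj x z) _ xz (not⁺ (vert z) z∉K))))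

  -- The last vertex outside the core on the way up is an outside neighbour of the root.
  climb-attached : ∀ n {x} → depth x ≡ suc n → T (attachment K (climb (suc n) x))
  climb-attached zero    {x} eq =
    attached (depth-0 (depth-pred eq)) (depth-suc eq) (adj-sym x (parent x) (parent-adj (depth-suc eq)))
  climb-attached (suc n) eq = climb-attached n (depth-pred eq)

  root-attached : ∀ {x} → ¬ T (vert x) → T (attachment K (root x))
  root-attached {x} x∉K = ≡.subst (λ n → T (attachment K (climb n x))) (≡.sym (depth-parent x∉K))
    (climb-attached (depth (parent x)) (depth-parent x∉K))

  φ : V → V̂
  φ x with T? (vert x)
  ... | yes x∈K = inj₁ (x , x∈K)
  ... | no  x∉K = inj₂ (root x , root-attached x∉K)

  core≡ : ∀ {x y} {p : T (vert x)} {q : T (vert y)} → x ≡ y → _≡_ {A = V̂} (inj₁ (x , p)) (inj₁ (y , q))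
  core≡ ≡.refl = ≡.cong (λ p → inj₁ (_ , p)) (T-irrelevant _ _)

  pendant≡ : ∀ {x y} {p : T (attachment K x)} {q : T (attachment K y)} → x ≡ y →
             _≡_ {A = V̂} (inj₂ (x , p)) (inj₂ (y , q))
  pendant≡ ≡.refl = ≡.cong (λ p → inj₂ (_ , p)) (T-irrelevant _ _)

  φ-core : ∀ {x} (p : T (vert x)) → φ x ≡ inj₁ (x , p)
  φ-core {x} p with T? (vert x)
  ... | yes _  = core≡ ≡.refl
  ... | no x∉K = contradiction p x∉K

  φ-hanging : ∀ {x r} → ¬ T (vert x) → root x ≡ r → (q : T (attachment K r)) → φ x ≡ inj₂ (r , q)
  φ-hanging {x} x∉K eq q with T? (vert x)
  ... | yes p = contradiction p x∉K
  ... | no _  = pendant≡ eq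

  φ-core⁻ : ∀ {x y p} → φ x ≡ inj₁ (y , p) → x ≡ y
  φ-core⁻ {x} eq with T? (vert x)
  φ-core⁻ ≡.refl | yes _ = ≡.refl
  φ-core⁻ ()     | no _

  φ-hanging⁻ : ∀ {x r q} → φ x ≡ inj₂ (r , q) → ¬ T (vert x) × root x ≡ r
  φ-hanging⁻ {x} eq with T? (vert x)
  φ-hanging⁻ ()     | yes _
  φ-hanging⁻ ≡.refl | no x∉K = x∉K , ≡.refl

  φ-descend : ∀ {x} → ¬ T (vert x) → ¬ T (vert (parent x)) → φ x ≡ φ (parent x)
  φ-descend {x} x∉K p∉K with T? (vert (parent x))
  ... | yes p∈K = contradiction p∈K p∉K
  ... | no  p∉K′ = φ-hanging x∉K (root-parent x∉K) (root-attached p∉K′)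

  φ-child : ∀ {x} → ¬ T (vert x) → T (vert (parent x)) → (q : T (attachment K (parent x))) →
            φ x ≡ inj₂ (parent x , q)
  φ-child x∉K p∈K = φ-hanging x∉K (≡.trans (root-parent x∉K) (root-core p∈K))

  -- A step up inside a tree stays in its fibre; only the final step into the core crosses a pendant
  -- edge.
  φ-parent : ∀ {x} → ¬ T (vert x) → φ x ≡ φ (parent x) ⊎ T (adĵ (φ x) (φ (parent x)))
  φ-parent {x} x∉K with T? (vert (parent x))
  ... | yes p∈K rewrite φ-child x∉K p∈K (attached p∈K x∉K (adj-sym x (parent x) (parent-adj x∉K)))
    = inj₂ (fromWitness {a? = parent x ≟ parent x} ≡.refl)
  ... | no p∉K = inj₁ (φ-hanging x∉K (root-parent x∉K) (root-attached p∉K))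

  φ-edge : ∀ {x y} → T (adj x y) → φ x ≡ φ y ⊎ T (adĵ (φ x) (φ y))
  φ-edge {x} {y} xy with edges xy
  ... | inj₁ e rewrite φ-core (edge-vert x y e) | φ-core (edge-vertʳ e) = inj₂ e
  ... | inj₂ (inj₁ (x∉K , ≡.refl)) = φ-parent x∉K
  ... | inj₂ (inj₂ (y∉K , ≡.refl)) with φ-parent y∉K
  ... | inj₁ eq = inj₁ (≡.sym eq)
  ... | inj₂ e  = inj₂ (FiniteGraph.adj-sym (K̂ K) (φ y) (φ (parent y)) e)

  φ-walk : ∀ {x y n} → Walk G x y n → ∃[ m ] (m ℕ.≤ n × Walk (K̂ K) (φ x) (φ y) m)
  φ-walk nil = 0 , z≤n , nil
  φ-walk {x} {y} (step xz w) with φ-walk w | φ-edge xz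
  ... | m , m≤ , v | inj₁ eq = m , ℕ.m≤n⇒m≤1+n m≤ , ≡.subst (λ u → Walk (K̂ K) u (φ y) m) (≡.sym eq) v
  ... | m , m≤ , v | inj₂ e  = suc m , s≤s m≤ , step e v

  -- The neighbour that makes `x` an attachment vertex is a child of `x`: the edge to it is not in
  -- `K`, and a core vertex is nobody's child.
  outside-neighbour : ∀ {x} → T (attachment K x) → ∃[ z ] (¬ T (vert z) × parent z ≡ x)
  outside-neighbour {x} q =
    let x∈K , some = ∧⁻ (vert x) _ q
        z , _ , t  = find (Any.any⁻ (λ z → adj x z ∧ not (vert z)) vertices some)
        xz , nz    = ∧⁻ (adj x z) _ t
        z∉K        = not⁻ (vert z) nz
    in z , z∉K , (case edges xz of λ
      { (inj₁ e)               → contradiction (edge-vertʳ e) z∉K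
      ; (inj₂ (inj₁ (x∉K , _))) → contradiction x∈K x∉K
      ; (inj₂ (inj₂ (_ , eq)))  → eq })

  attachment-core : ∀ {x} → T (attachment K x) → T (vert x)
  attachment-core {x} q = proj₁ (∧⁻ (vert x) _ q)

  -- Surjectivity of `φ` makes K̂ connected. The depth bound is for the spreading kernel: it shows
  -- that the set over which the mass at `u` is spread is nonempty.
  section : ∀ u → ∃[ x ] (φ x ≡ u × depth x ℕ.≤ 1)
  section (inj₁ (x , p)) = x , φ-core p , ℕ.≤-trans (ℕ.≤-reflexive (depth-core x p)) z≤n
  section (inj₂ (x , q)) with outside-neighbour q
  ... | z , z∉K , ≡.refl = z
    , φ-hanging z∉K (≡.trans (root-parent z∉K) (root-core (attachment-core q))) q
    , ℕ.≤-reflexive (≡.trans (depth-parent z∉K) (≡.cong suc (depth-core _ (attachment-core q))))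

  K̂-connected : Connected G → Connected (K̂ K)
  K̂-connected connected u v with section u | section v
  ... | x , ≡.refl , _ | y , ≡.refl , _ = let m , _ , w = φ-walk (proj₂ (connected x y)) in m , w

  foot : V̂ → V
  foot (inj₁ (x , _)) = x
  foot (inj₂ (x , _)) = x

  -- Folding each pendant vertex onto its attachment vertex makes pendant edges stationary, so they
  -- drop out and the walk can only get shorter.
  foot-walk : ∀ {u v n} → Walk (K̂ K) u v n → ∃[ m ] (m ℕ.≤ n × Walk G (foot u) (foot v) m)
  foot-walk nil = 0 , z≤n , nil
  foot-walk {v = t} (step {u} {v} uv w) with foot-walk w
  ... | m , m≤ , w′ = go u v uv w′
    where
    go : ∀ u v → T (adĵ u v) → Walk G (foot v) (foot t) m → ∃[ m ] (m ℕ.≤ _ × Walk G (foot u) (foot t) m)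
    go (inj₁ (x , _)) (inj₁ (y , _)) e w = suc m , s≤s m≤ , step (edge-adj x y e) w
    go (inj₁ (x , _)) (inj₂ (y , _)) e w = m , ℕ.m≤n⇒m≤1+n m≤ ,
      ≡.subst (λ z → Walk G z (foot t) m) (≡.sym (toWitness {a? = x ≟ y} e)) w
    go (inj₂ (x , _)) (inj₁ (y , _)) e w = m , ℕ.m≤n⇒m≤1+n m≤ ,
      ≡.subst (λ z → Walk G z (foot t) m) (≡.sym (toWitness {a? = x ≟ y} e)) w

  root-near : ∀ {x} → ¬ T (vert x) → depth x ℕ.≤ 1 → root x ≡ parent x
  root-near {x} x∉K ≤1 = ≡.trans (root-parent x∉K)
    (root-core (depth-0 (ℕ.n≤0⇒n≡0 (ℕ.≤-pred (≡.subst (ℕ._≤ 1) (depth-parent x∉K) ≤1)))))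

  -- Contains the support of the spreading kernel: `x^∂` is spread over neighbours of `x`, and a
  -- core vertex stays where it is.
  data Covers : V → V̂ → Set where
    core  : ∀ {x p} → Covers x (inj₁ (x , p))
    child : ∀ {x z q} → T (adj z x) → Covers z (inj₂ (x , q))

  covers : ∀ {x} → depth x ℕ.≤ 1 → Covers x (φ x)
  covers {x} ≤1 with T? (vert x)
  ... | yes x∈K = core
  ... | no  x∉K = child (≡.subst (λ r → T (adj x r))
    (≡.sym (root-near x∉K ≤1))
    (parent-adj x∉K))

  lift-start : ∀ {x u y p n} → Covers x u → Walk (K̂ K) u (inj₁ (y , p)) n → ∃[ m ] (m ℕ.≤ n × Walk G x y m)
  lift-start core w = foot-walk w
  lift-start (child {x} {z} zx) (step {y = inj₁ (x′ , _)} e w) with toWitness {a? = x ≟ x′} e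
  ... | ≡.refl = let m , m≤ , v = foot-walk w in suc m , s≤s m≤ , step zx v

  -- A nonempty walk starts and ends at a pendant vertex by a pendant edge, which is replaced by the
  -- edge to the chosen neighbour; the middle is folded by `foot-walk`. The hypothesis on u ≡ v
  -- rules out the empty walk at a pendant vertex, which need not lift because two different
  -- neighbours may have been chosen.
  lift-walk : ∀ {x y u v n} → Covers x u → Covers y v → (u ≡ v → ∃[ z ] u ≡ inj₁ z) →
              Walk (K̂ K) u v n → ∃[ m ] (m ℕ.≤ n × Walk G x y m)
  lift-walk cu core distinct w = lift-start cu w
  lift-walk {n = n} cu (child {y} {z} zy) distinct w = go (Walks.reverse (K̂ K) w)
    where
    go : Walk (K̂ K) _ _ n → _
    go nil with distinct ≡.refl
    ... | _ , ()
    go (step {y = inj₁ (y′ , _)} e w′) with toWitness {a? = y ≟ y′} e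
    ... | ≡.refl = let m , m≤ , v = lift-start cu (Walks.reverse (K̂ K) w′) in
      suc m , s≤s m≤ , Walks.snoc G v (adj-sym z y zy)

-- From G to K̂

module Collapse (ℛ : CompleteOrderedField) {G : FiniteGraph} (K : Subgraph G) (hanging : Hanging K (λ _ → true))
                (D : GraphDistance G) (D̂ : GraphDistance (K̂ K))
                (weight : Curvature.Weight ℛ G) (admissible : Curvature.Admissible ℛ G D weight) where
  open OrderedField ℛ
  open ≤-Reasoning
  open FiniteGraph G renaming (_≟_ to _≟ᵛ_)
  open Subgraph K hiding (degree)
  open Hanging hanging using (parent)
  open Retraction K hanging
  open Curvature.Weight weight
  private
    module Ĝ = FiniteGraph (K̂ K)
    module Ĉ = CouplingCost ℛ (K̂ K) D̂
    module L = LazyWalk ℛ G D weight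

  k : V → Ĝ.V → ℝ
  k a v = Ĉ.δ (φ a) v

  k-nonneg : ∀ a v → 0# ≤ k a v
  k-nonneg a v = 𝟙-nonneg (v Ĝ.≟ φ a)

  -- The image of `w x` under `φ`: core edges keep their weight, and the pendant edge at `x`
  -- collects all tree edges at `x`. Degrees at core vertices are preserved, so the walks correspond
  -- exactly.
  ŵ-core : V → Ĝ.V → ℝ
  ŵ-core x v = ∑ G λ b → w x b * k b v

  ŵ : Ĝ.V → Ĝ.V → ℝ
  ŵ (inj₁ (x , _)) v              = ŵ-core x v
  ŵ (inj₂ u)       (inj₁ (x , _)) = ŵ-core x (inj₂ u)
  ŵ (inj₂ _)       (inj₂ _)       = 0#

  ŵ-core≈w : ∀ x {y} q → ŵ-core x (inj₁ (y , q)) ≈ w x y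
  ŵ-core≈w x {y} q = trans
    (∑-single G y λ b b≢y → trans (*-congˡ (Ĉ.δ-other λ eq → b≢y (φ-core⁻ (≡.sym eq)))) (zeroʳ _))
    (trans (*-congˡ (𝟙-yes (_ Ĝ.≟ φ y) (≡.sym (φ-core q)))) (*-identityʳ _))

  ŵ-core-positive : ∀ x q → 0# < ŵ-core x (inj₂ (x , q))
  ŵ-core-positive x q = positive-at (outside-neighbour q)
    where
    positive-at : ∃[ z ] (¬ T (vert z) × parent z ≡ x) → 0# < ŵ-core x (inj₂ (x , q))
    positive-at (z , z∉K , ≡.refl) = <-≤-trans (positive x z (adj-sym z x (parent-adj z∉K))) (begin
      w x z                         ≈⟨ *-identityʳ _ ⟨
      w x z * 1#                    ≈⟨ *-congˡ (𝟙-yes (_ Ĝ.≟ φ z) (≡.sym (φ-hanging z∉K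
                                         (≡.trans (root-parent z∉K) (root-core (attachment-core q))) q))) ⟨
      w x z * k z (inj₂ (x , q))
        ≤⟨ term-≤-sum (λ b → *-nonneg (L.w-nonneg x b) (k-nonneg b _)) (complete z) ⟩
      ŵ-core x (inj₂ (x , q))       ∎)

  -- A neighbour of `x` outside the core is a child of `x` and so has root `x`; it cannot be sent to
  -- `y^∂`.
  ŵ-core-off : ∀ {x y} q → T (vert x) → x ≢ y → ŵ-core x (inj₂ (y , q)) ≈ 0#
  ŵ-core-off {x} {y} q x∈K x≢y = sum-zero vertices vanish
    where
    vanish : ∀ b → w x b * k b (inj₂ (y , q)) ≈ 0#
    vanish b with inj₂ (y , q) Ĝ.≟ φ b
    ... | no _   = zeroʳ _
    ... | yes eq = trans (*-congʳ (off-edge x b not-adjacent)) (zeroˡ _)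
      where
      b∉K = proj₁ (φ-hanging⁻ (≡.sym eq))
      not-adjacent : ¬ T (adj x b)
      not-adjacent xb with edges xb
      ... | inj₁ e               = b∉K (edge-vertʳ e)
      ... | inj₂ (inj₁ (x∉K , _)) = x∉K x∈K
      ... | inj₂ (inj₂ (_ , ≡.refl)) =
        x≢y (≡.trans (≡.sym (root-core x∈K)) (≡.trans (≡.sym (root-parent b∉K))
            (proj₂ (φ-hanging⁻ (≡.sym eq)))))

  collapsed : Curvature.Weight ℛ (K̂ K)
  collapsed = record
    { w        = ŵ
    ; w-sym    = ŵ-sym
    ; positive = ŵ-positive
    ; off-edge = ŵ-off
    }
    where
    ŵ-sym : ∀ u v → ŵ u v ≈ ŵ v u
    ŵ-sym (inj₁ (x , p)) (inj₁ (y , q)) = trans (ŵ-core≈w x q) (trans (w-sym x y) (sym (ŵ-core≈w y p)))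
    ŵ-sym (inj₁ _)       (inj₂ _)       = refl
    ŵ-sym (inj₂ _)       (inj₁ _)       = refl
    ŵ-sym (inj₂ _)       (inj₂ _)       = refl
    ŵ-positive : ∀ u v → T (Ĝ.adj u v) → 0# < ŵ u v
    ŵ-positive (inj₁ (x , p)) (inj₁ (y , q)) e =
      <-≤-trans (positive x y (edge-adj x y e)) (≤-reflexive (sym (ŵ-core≈w x q)))
    ŵ-positive (inj₁ (x , _)) (inj₂ (y , q)) e with toWitness {a? = x ≟ᵛ y} e
    ... | ≡.refl = ŵ-core-positive x q
    ŵ-positive (inj₂ (x , q)) (inj₁ (y , _)) e with toWitness {a? = x ≟ᵛ y} e
    ... | ≡.refl = ŵ-core-positive x q
    ŵ-off : ∀ u v → ¬ T (Ĝ.adj u v) → ŵ u v ≈ 0#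
    ŵ-off (inj₁ (x , p)) (inj₁ (y , q)) ¬e = trans (ŵ-core≈w x q) (off-edge x y λ xy → case edges xy of λ
      { (inj₁ e)                → ¬e e
      ; (inj₂ (inj₁ (x∉K , _))) → x∉K p
      ; (inj₂ (inj₂ (y∉K , _))) → y∉K q })
    ŵ-off (inj₁ (x , p)) (inj₂ (y , q)) ¬e = ŵ-core-off q p λ x≡y → ¬e (fromWitness {a? = x ≟ᵛ y} x≡y)
    ŵ-off (inj₂ (x , q)) (inj₁ (y , p)) ¬e = ŵ-core-off q p λ y≡x → ¬e (fromWitness {a? = x ≟ᵛ y} (≡.sym y≡x))
    ŵ-off (inj₂ _)       (inj₂ _)       ¬e = refl

  private
    module Ŵ = Curvature.Weight collapsed
    module L̂ = LazyWalk ℛ (K̂ K) D̂ collapsed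

  deg-core : ∀ x p → Ŵ.deg (inj₁ (x , p)) ≈ deg x
  deg-core x p = begin-equality
    ∑ (K̂ K) (λ v → ∑ G (λ b → w x b * k b v))  ≈⟨ sum-swap Ĝ.vertices vertices (λ v b → w x b * k b v) ⟩
    ∑ G (λ b → ∑ (K̂ K) (λ v → w x b * k b v))
      ≈⟨ sum-cong vertices (λ b → trans (sum-*ˡ Ĝ.vertices (w x b) (k b))
                                                     (trans (*-congˡ (Ĉ.∑-δ (φ b))) (*-identityʳ _))) ⟩
    deg x                                       ∎

  deg-pendant : ∀ x q p → Ŵ.deg (inj₂ (x , q)) ≈ ŵ (inj₂ (x , q)) (inj₁ (x , p))
  deg-pendant x q p = ∑-single (K̂ K) (inj₁ (x , p)) λ v v≢ → Ŵ.off-edge (inj₂ (x , q)) v λ e → v≢ (only v e)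
    where
    only : ∀ v → T (Ĝ.adj (inj₂ (x , q)) v) → v ≡ inj₁ (x , p)
    only (inj₁ (y , _)) e = core≡ (≡.sym (toWitness {a? = x ≟ᵛ y} e))

  -- At a leaf the degree is the weight of its one edge, so the left side vanishes.
  leaf-dominant : ∀ {a b m} → b ≈ m → (a - m) * (b - m) ≤ m * m
  leaf-dominant {a} {b} {m} b≈m = certify (m * m) (square m) (sym (trans (+-congʳ (trans (*-congˡ
      (trans (+-congʳ b≈m) (-‿inverseʳ m))) (zeroʳ _))) (+-identityˡ _)))
    where
    square : ∀ m → 0# ≤ m * m
    square m with total 0# m
    ... | inj₁ 0≤m = *-nonneg 0≤m 0≤m
    ... | inj₂ m≤0 = ≤-trans (*-nonneg 0≤-m 0≤-m)
      (≤-reflexive (solve 1 (λ m → (:- m) :* (:- m) := m :* m) refl m))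
      where
      0≤-m = ≤-trans (≤⇒0≤- m≤0) (≤-reflexive (+-identityˡ (- m)))

  push-p : ∀ x p v → Transport.push ℛ D D̂ k (L.p x) v ≈ L̂.p (inj₁ (x , p)) v
  push-p x p v = begin-equality
    ∑ G (λ a → w x a * deg x ⁻¹ * k a v)
      ≈⟨ sum-cong vertices (λ a → solve 3 (λ w i k → w :* i :* k := w :* k :* i)
          refl (w x a) (deg x ⁻¹) (k a v)) ⟩
    ∑ G (λ a → w x a * k a v * deg x ⁻¹)
      ≈⟨ sum-*ʳ vertices (deg x ⁻¹) (λ a → w x a * k a v) ⟩
    ŵ-core x v * deg x ⁻¹
      ≈⟨ *-congˡ (⁻¹-cong (deg-core x p)) ⟨
    L̂.p (inj₁ (x , p)) v ∎

  collapsed-contracting : ∀ u v (uv : T (Ĝ.adj u v)) → L̂.Edge.NearlyContracting u v uv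
  collapsed-contracting (inj₁ (x , p)) (inj₁ (y , q)) e =
    CurvatureTransport.contracting-push ℛ D D̂ weight collapsed x y (inj₁ (x , p)) (inj₁ (y , q))
        (edge-adj x y e) e k k-nonneg (λ a → Ĉ.∑-δ (φ a))
      (λ v → reflexive (≡.cong (λ u → Ĉ.δ u v) (φ-core p)))
          (λ v → reflexive (≡.cong (λ u → Ĉ.δ u v) (φ-core q)))
      (push-p x p) (push-p y q) (λ _ → shorter)
          (admissible⇒contracting D weight admissible x y (edge-adj x y e))
    where
    open GraphDistance
    shorter : ∀ {R : V → V → Set} a a′ v v′ → R a a′ ⊎ k a v ≈ 0# ⊎ k a′ v′ ≈ 0# ⊎ d D̂ v v′ ℕ.≤ d D a a′
    shorter a a′ v v′ with v Ĝ.≟ φ a | v′ Ĝ.≟ φ a′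
    ... | no _       | _          = inj₂ (inj₁ refl)
    ... | yes _      | no _       = inj₂ (inj₂ (inj₁ refl))
    ... | yes ≡.refl | yes ≡.refl = let m , m≤ , ŵalk = φ-walk (attained D a a′) in
      inj₂ (inj₂ (inj₂ (ℕ.≤-trans (minimal D̂ _ _ m ŵalk) m≤)))
  collapsed-contracting (inj₁ (x , p)) (inj₂ (y , q)) e =
    L̂.Edge.dominant⇒contracting (inj₁ (x , p)) (inj₂ (y , q)) e (leaf-dominant (pendant e))
    where
    pendant : T ⌊ x ≟ᵛ y ⌋ → Ŵ.deg (inj₂ (y , q)) ≈ ŵ (inj₁ (x , p)) (inj₂ (y , q))
    pendant e with toWitness {a? = x ≟ᵛ y} e
    ... | ≡.refl = deg-pendant x q p
  collapsed-contracting (inj₂ (y , q)) (inj₁ (x , p)) e =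
    L̂.Edge.dominant⇒contracting (inj₂ (y , q)) (inj₁ (x , p)) e (≤-trans (≤-reflexive (*-comm _ _)) (leaf-dominant (pendant e)))
    where
    pendant : T ⌊ y ≟ᵛ x ⌋ → Ŵ.deg (inj₂ (y , q)) ≈ ŵ (inj₂ (y , q)) (inj₁ (x , p))
    pendant e with toWitness {a? = y ≟ᵛ x} e
    ... | ≡.refl = deg-pendant x q p

  collapsed-admissible : Curvature.Admissible ℛ (K̂ K) D̂ collapsed
  collapsed-admissible = contracting⇒admissible D̂ collapsed collapsed-contracting

-- From K̂ to G

module Expand (ℛ : CompleteOrderedField) {G : FiniteGraph} (K : Subgraph G) (hanging : Hanging K (λ _ → true))
              (D : GraphDistance G) (D̂ : GraphDistance (K̂ K)) (edge₀ : HasEdge (K̂ K))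
              (weight : Curvature.Weight ℛ (K̂ K)) (admissible : Curvature.Admissible ℛ (K̂ K) D̂ weight) where
  open OrderedField ℛ
  open ≤-Reasoning
  open FiniteGraph G renaming (_≟_ to _≟ᵛ_)
  open Subgraph K hiding (degree)
  open Hanging hanging using (depth; parent; depth-core)
  open Retraction K hanging
  private
    module Ĝ = FiniteGraph (K̂ K)
    module Ĉ = CouplingCost ℛ (K̂ K) D̂
    module L̂ = LazyWalk ℛ (K̂ K) D̂ weight
    module Ŵ = Curvature.Weight weight
    module CG = CouplingCost ℛ G D
  open Ŵ using () renaming (w to ŵ)

  -- The mass at a pendant vertex x^∂ is spread evenly over the neighbours of x outside K.
  near : V → ℝ
  near a = 𝟙 (depth a ℕ.≤? 1)

  near-nonneg : ∀ a → 0# ≤ near a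
  near-nonneg a = 𝟙-nonneg (depth a ℕ.≤? 1)

  fibre : Ĝ.V → ℝ
  fibre u = ∑ G λ a → 𝟙 (φ a Ĝ.≟ u) * near a

  1≤fibre : ∀ u → 1# ≤ fibre u
  1≤fibre u = at (section u)
    where
    at : ∃[ x ] (φ x ≡ u × depth x ℕ.≤ 1) → 1# ≤ fibre u
    at (x , eq , ≤1) = begin
      1#                             ≈⟨ *-identityˡ 1# ⟨
      1# * 1#                        ≈⟨ *-cong (𝟙-yes (φ x Ĝ.≟ u) eq) (𝟙-yes (depth x ℕ.≤? 1) ≤1) ⟨
      𝟙 (φ x Ĝ.≟ u) * near x
        ≤⟨ term-≤-sum (λ a → *-nonneg (𝟙-nonneg (φ a Ĝ.≟ u)) (near-nonneg a)) (complete x) ⟩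
      fibre u                        ∎

  0<fibre : ∀ u → 0# < fibre u
  0<fibre u = <-≤-trans 0<1 (1≤fibre u)

  0≤fibre⁻¹ : ∀ u → 0# ≤ fibre u ⁻¹
  0≤fibre⁻¹ u = proj₁ (⁻¹-positive (0<fibre u))

  fibre⁻¹≤1 : ∀ u → fibre u ⁻¹ ≤ 1#
  fibre⁻¹≤1 u = begin
    fibre u ⁻¹             ≈⟨ *-identityˡ _ ⟨
    1# * fibre u ⁻¹        ≤⟨ *-monoʳ-≤ (0≤fibre⁻¹ u) (1≤fibre u) ⟩
    fibre u * fibre u ⁻¹   ≈⟨ ⁻¹-inverseʳ (0<fibre u) ⟩
    1#                     ∎

  -- Normalised by the fibre of `a` itself, so that it depends on `a` alone and factors out of sums
  -- over the vertices of K̂.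
  share : V → ℝ
  share a = near a * fibre (φ a) ⁻¹

  k : Ĝ.V → V → ℝ
  k u a = 𝟙 (φ a Ĝ.≟ u) * share a

  k-nonneg : ∀ u a → 0# ≤ k u a
  k-nonneg u a = *-nonneg (𝟙-nonneg (φ a Ĝ.≟ u)) (*-nonneg (near-nonneg a) (0≤fibre⁻¹ (φ a)))

  k-total : ∀ u → ∑ G (k u) ≈ 1#
  k-total u = begin-equality
    ∑ G (k u)
      ≈⟨ sum-cong vertices regroup ⟩
    ∑ G (λ a → 𝟙 (φ a Ĝ.≟ u) * near a * fibre u ⁻¹)
      ≈⟨ sum-*ʳ vertices (fibre u ⁻¹) (λ a → 𝟙 (φ a Ĝ.≟ u) * near a) ⟩
    fibre u * fibre u ⁻¹
      ≈⟨ ⁻¹-inverseʳ (0<fibre u) ⟩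
    1# ∎
    where
    regroup : ∀ a → k u a ≈ 𝟙 (φ a Ĝ.≟ u) * near a * fibre u ⁻¹
    regroup a with φ a Ĝ.≟ u
    ... | yes ≡.refl = sym (*-assoc _ _ _)
    ... | no _       = trans (zeroˡ _) (sym (trans (*-congʳ (zeroˡ _)) (zeroˡ _)))

  k-core-off : ∀ {x p a} → a ≢ x → k (inj₁ (x , p)) a ≈ 0#
  k-core-off {x} {p} {a} a≢x = trans (*-congʳ (𝟙-no (φ a Ĝ.≟ inj₁ (x , p)) (a≢x ∘ φ-core⁻))) (zeroˡ _)

  -- The fibre over a core vertex is that vertex alone, so total mass 1 forces the value there.
  k-core : ∀ x p a → k (inj₁ (x , p)) a ≈ CG.δ x a
  k-core x p a with a ≟ᵛ x
  ... | yes ≡.refl = trans (sym (∑-single G x λ _ → k-core-off)) (k-total (inj₁ (x , p)))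
  ... | no a≢x     = k-core-off a≢x

  share-core : ∀ {x} → T (vert x) → share x ≈ 1#
  share-core {x} p = begin-equality
    share x                                    ≈⟨ *-identityˡ _ ⟨
    1# * share x                               ≈⟨ *-congʳ (𝟙-yes (φ x Ĝ.≟ inj₁ (x , p)) (φ-core p)) ⟨
    k (inj₁ (x , p)) x                         ≈⟨ k-core x p x ⟩
    CG.δ x x                                   ≈⟨ CG.δ-same x ⟩
    1#                                         ∎

  -- The bounds on ε keep w_z small compared with w_y² for every child z of y, which is what the
  -- domination criterion at the edge from y to its parent asks for.
  N Total D₀ ε : ℝ
  N     = ∑ G (λ _ → 1#)
  Total = ∑ (K̂ K) Ŵ.deg
  D₀    = Total + Total
  ε     = (N * D₀) ⁻¹

  1≤N : 1# ≤ N
  1≤N = term-≤-sum (λ _ → 0≤1) (complete (foot (proj₁ edge₀)))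

  deĝ≤Total : ∀ u → Ŵ.deg u ≤ Total
  deĝ≤Total u = term-≤-sum L̂.deg-nonneg (Ĝ.complete u)

  0<Total : 0# < Total
  0<Total = <-≤-trans (L̂.deg-positive (proj₂ (proj₂ edge₀))) (deĝ≤Total (proj₁ edge₀))

  Total≤D₀ : Total ≤ D₀
  Total≤D₀ = certify Total (proj₁ 0<Total) refl

  0<ND₀ : 0# < N * D₀
  0<ND₀ = *-positive (<-≤-trans 0<1 1≤N) (<-≤-trans 0<Total Total≤D₀)

  0<ε : 0# < ε
  0<ε = ⁻¹-positive 0<ND₀

  N*Total*ε≤1 : N * Total * ε ≤ 1#
  N*Total*ε≤1 = begin
    N * Total * ε ≤⟨ *-monoʳ-≤ (proj₁ 0<ε) (*-monoˡ-≤ (≤-trans 0≤1 1≤N) Total≤D₀) ⟩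
    N * D₀ * ε    ≈⟨ ⁻¹-inverseʳ 0<ND₀ ⟩
    1#            ∎

  Total*ε≤1 : Total * ε ≤ 1#
  Total*ε≤1 = begin
    Total * ε      ≈⟨ *-congʳ (*-identityˡ _) ⟨
    1# * Total * ε ≤⟨ *-monoʳ-≤ (proj₁ 0<ε) (*-monoʳ-≤ (proj₁ 0<Total) 1≤N) ⟩
    N * Total * ε  ≤⟨ N*Total*ε≤1 ⟩
    1#             ∎

  -- The domination criterion solved for the next level: below an edge of weight s, at most N child
  -- edges of weight s² ε weigh together at most s² / D₀.
  shrink : ℕ → ℝ → ℝ
  shrink zero    t = t
  shrink (suc n) t = shrink n t * shrink n t * ε

  shrink-positive : ∀ n {t} → 0# < t → 0# < shrink n t
  shrink-positive zero    0<t = 0<t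
  shrink-positive (suc n) 0<t = *-positive (*-positive (shrink-positive n 0<t) (shrink-positive n 0<t)) 0<ε

  -- Weights do not grow down a tree: s ≤ Total gives s ε ≤ Total ε ≤ 1, hence s² ε ≤ s.
  shrink≤Total : ∀ n {t} → 0# < t → t ≤ Total → shrink n t ≤ Total
  shrink≤Total zero        0<t t≤ = t≤
  shrink≤Total (suc n) {t} 0<t t≤ = begin
    s * s * ε      ≈⟨ *-assoc s s ε ⟩
    s * (s * ε)    ≤⟨ *-monoˡ-≤ 0≤s (*-monoʳ-≤ (proj₁ 0<ε) s≤Total) ⟩
    s * (Total * ε) ≤⟨ *-monoˡ-≤ 0≤s Total*ε≤1 ⟩
    s * 1#         ≈⟨ *-identityʳ s ⟩
    s              ≤⟨ s≤Total ⟩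
    Total          ∎
    where
    s = shrink n t
    0≤s = proj₁ (shrink-positive n 0<t)
    s≤Total = shrink≤Total n 0<t t≤

  -- At `x^∂`, an equal split of the pendant weight over the children of `x`, so that the edges from
  -- `x` into its trees add up to that weight.
  top : Ĝ.V → ℝ
  top (inj₁ _)       = 1#
  top (inj₂ (x , q)) = ŵ (inj₁ (x , attachment-core q)) (inj₂ (x , q)) * fibre (inj₂ (x , q)) ⁻¹

  top-bounds : ∀ {y} → ¬ T (vert y) → 0# < top (φ y) × top (φ y) ≤ Total
  top-bounds {y} y∉K = ≡.subst (λ u → 0# < top u × top u ≤ Total)
    (≡.sym (φ-hanging y∉K ≡.refl (root-attached y∉K))) (bounds (root y) (root-attached y∉K))
    where
    bounds : ∀ x q → 0# < top (inj₂ (x , q)) × top (inj₂ (x , q)) ≤ Total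
    bounds x q = *-positive (Ŵ.positive u v (fromWitness {a? = x ≟ᵛ x} ≡.refl)) (⁻¹-positive (0<fibre v)) ,
        (begin
      ŵ u v * fibre v ⁻¹ ≤⟨ *-monoˡ-≤ (L̂.w-nonneg u v) (fibre⁻¹≤1 v) ⟩
      ŵ u v * 1#         ≈⟨ *-identityʳ _ ⟩
      ŵ u v              ≤⟨ L̂.w≤deg u v ⟩
      Ŵ.deg u            ≤⟨ deĝ≤Total u ⟩
      Total              ∎)
      where
      u = inj₁ (x , attachment-core q)
      v = inj₂ (x , q)

  -- The weight of the edge from y to its parent, squared (and scaled) at each level.
  up : V → ℝ
  up y = shrink (ℕ.pred (depth y)) (top (φ y))

  up-positive : ∀ {y} → ¬ T (vert y) → 0# < up y
  up-positive {y} y∉K = shrink-positive (ℕ.pred (depth y)) (proj₁ (top-bounds y∉K))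

  up≤Total : ∀ {y} → ¬ T (vert y) → up y ≤ Total
  up≤Total {y} y∉K = shrink≤Total (ℕ.pred (depth y)) (proj₁ (top-bounds y∉K)) (proj₂ (top-bounds y∉K))

  up-child : ∀ {z} → ¬ T (vert z) → ¬ T (vert (parent z)) → up z ≈ up (parent z) * up (parent z) * ε
  up-child {z} z∉K p∉K rewrite depth-parent z∉K | depth-parent p∉K | φ-descend z∉K p∉K = refl

  up-top : ∀ {z} → ¬ T (vert z) → T (vert (parent z)) → up z ≈ top (φ z)
  up-top {z} z∉K p∈K rewrite depth-parent z∉K | depth-core (parent z) p∈K = refl

  IsChild? : ∀ a b → Dec (parent b ≡ a × ¬ T (vert b))
  IsChild? a b = (parent b ≟ᵛ a) ×-dec ¬? (T? (vert b))

  down : V → V → ℝ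
  down a b = 𝟙 (IsChild? a b) * up b

  down-child : ∀ {b} → ¬ T (vert b) → down (parent b) b ≈ up b
  down-child {b} b∉K = trans (*-congʳ (𝟙-yes (IsChild? (parent b) b) (≡.refl , b∉K))) (*-identityˡ _)

  down-off : ∀ {a b} → ¬ (parent b ≡ a × ¬ T (vert b)) → down a b ≈ 0#
  down-off {a} {b} ¬child = trans (*-congʳ (𝟙-no (IsChild? a b) ¬child)) (zeroˡ _)

  down-nonneg : ∀ a b → 0# ≤ down a b
  down-nonneg a b with IsChild? a b
  ... | yes (_ , b∉K) = *-nonneg 0≤1 (proj₁ (up-positive b∉K))
  ... | no _          = ≤-reflexive (sym (zeroˡ _))

  inside : V → V → ℝ
  inside a b with T? (vert a) | T? (vert b)
  ... | yes p | yes q = ŵ (inj₁ (a , p)) (inj₁ (b , q))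
  ... | _     | _     = 0#

  inside-core : ∀ {a b} p q → inside a b ≈ ŵ (inj₁ (a , p)) (inj₁ (b , q))
  inside-core {a} {b} p q with T? (vert a) | T? (vert b)
  ... | yes p′ | yes q′ = reflexive (≡.cong₂ ŵ (core≡ ≡.refl) (core≡ ≡.refl))
  ... | no a∉K | _      = contradiction p a∉K
  ... | yes _  | no b∉K = contradiction q b∉K

  inside-offˡ : ∀ {a b} → ¬ T (vert a) → inside a b ≈ 0#
  inside-offˡ {a} a∉K with T? (vert a)
  ... | yes a∈K = contradiction a∈K a∉K
  ... | no _    = refl

  inside-nonneg : ∀ a b → 0# ≤ inside a b
  inside-nonneg a b with T? (vert a) | T? (vert b)
  ... | yes p | yes q = L̂.w-nonneg _ _
  ... | yes _ | no _  = ≤-refl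
  ... | no _  | _     = ≤-refl

  inside-sym : ∀ a b → inside a b ≈ inside b a
  inside-sym a b with T? (vert a) | T? (vert b)
  ... | yes p | yes q = Ŵ.w-sym _ _
  ... | yes _ | no _  = refl
  ... | no _  | yes _ = refl
  ... | no _  | no _  = refl

  -- At most one summand is nonzero: `inside` lives on pairs of core vertices, and the two `down`
  -- terms on the two orientations of a tree edge.
  w : V → V → ℝ
  w a b = inside a b + (down a b + down b a)

  expanded : Curvature.Weight ℛ G
  expanded = record
    { w        = w
    ; w-sym    = λ a b → +-cong (inside-sym a b) (+-comm _ _)
    ; positive = w-positive
    ; off-edge = w-off
    }
    where
    w-positive : ∀ a b → T (adj a b) → 0# < w a b
    w-positive a b ab with edges ab
    ... | inj₁ e = <-≤-trans
      (Ŵ.positive (inj₁ (a , edge-vert a b e)) (inj₁ (b , edge-vertʳ e)) e)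
      (certify _ (+-nonneg (down-nonneg a b) (down-nonneg b a)) (+-congʳ (inside-core _ _)))
    ... | inj₂ (inj₁ (a∉K , ≡.refl)) = <-≤-trans (up-positive a∉K)
      (certify _ (+-nonneg (inside-nonneg a b) (down-nonneg a b))
        (trans (+-congˡ (+-congˡ (down-child a∉K))) (solve 3 (λ i d u → i :+ (d :+ u) := u :+ (i :+ d))
            refl _ _ _)))
    ... | inj₂ (inj₂ (b∉K , ≡.refl)) = <-≤-trans (up-positive b∉K)
      (certify _ (+-nonneg (inside-nonneg a b) (down-nonneg b a))
        (trans (+-congˡ (+-congʳ (down-child b∉K))) (solve 3 (λ i d u → i :+ (u :+ d) := u :+ (i :+ d))
            refl _ _ _)))
    inside-off-edge : ∀ a b → ¬ T (adj a b) → inside a b ≈ 0#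
    inside-off-edge a b ¬ab with T? (vert a) | T? (vert b)
    ... | yes p | yes q = Ŵ.off-edge _ _ λ e → ¬ab (edge-adj a b e)
    ... | yes _ | no _  = refl
    ... | no _  | _     = refl
    w-off : ∀ a b → ¬ T (adj a b) → w a b ≈ 0#
    w-off a b ¬ab = trans (+-cong (inside-off-edge a b ¬ab) (trans (+-cong
        (down-off {a} {b} λ { (≡.refl , b∉K) → ¬ab (adj-sym b a (parent-adj b∉K)) })
        (down-off {b} {a} λ { (≡.refl , a∉K) → ¬ab (parent-adj a∉K) }))
      (+-identityˡ 0#))) (+-identityˡ 0#)

  private
    module W = Curvature.Weight expanded
    module L = LazyWalk ℛ G D expanded

  ŵ-share : ∀ {u b v} → φ b ≡ v → ŵ u (φ b) * share b ≈ ŵ u v * share b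
  ŵ-share {u} eq = *-congʳ (reflexive (≡.cong (ŵ u) eq))

  down-core : ∀ {a b} → T (vert b) → down a b ≈ 0#
  down-core b∈K = down-off λ (_ , b∉K) → b∉K b∈K

  share-far : ∀ {b} → ¬ (depth b ℕ.≤ 1) → share b ≈ 0#
  share-far {b} far = trans (*-congʳ (𝟙-no (depth b ℕ.≤? 1) far)) (zeroˡ _)

  -- Seen from a core vertex, the expanded weight is the K̂ weight spread by the kernel; equality of
  -- degrees and of walks both follow. For a `b` that is neither in the core nor a child of `x` both
  -- sides vanish: either `b` is too deep to get a share, or its root is its parent and differs from
  -- `x`.
  w-core : ∀ x p b → w x b ≈ ŵ (inj₁ (x , p)) (φ b) * share b
  w-core x p b = case T? (vert b) of λ
    { (yes b∈K) → in-core b∈K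
    ; (no b∉K)  → trans (outside b∉K) (case parent b ≟ᵛ x of λ
      { (yes b≡x) → at-child b∉K b≡x
      ; (no b≢x)     → elsewhere b∉K b≢x }) }
    where
    u = inj₁ (x , p)
    in-core : T (vert b) → w x b ≈ ŵ u (φ b) * share b
    in-core q = begin-equality
      inside x b + (down x b + down b x)
        ≈⟨ +-cong (inside-core p q) (trans (+-cong (down-core q) (down-core p)) (+-identityˡ 0#)) ⟩
      ŵ u (inj₁ (b , q)) + 0#            ≈⟨ trans (+-identityʳ _) (sym (*-identityʳ _)) ⟩
      ŵ u (inj₁ (b , q)) * 1#            ≈⟨ *-congˡ (share-core q) ⟨
      ŵ u (inj₁ (b , q)) * share b       ≈⟨ ŵ-share (φ-core q) ⟨
      ŵ u (φ b) * share b                ∎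
    outside : ¬ T (vert b) → w x b ≈ down x b
    outside b∉K = begin-equality
      inside x b + (down x b + down b x)
        ≈⟨ +-cong (trans (inside-sym x b) (inside-offˡ b∉K)) (+-congˡ (down-core p)) ⟩
      0# + (down x b + 0#)               ≈⟨ trans (+-identityˡ _) (+-identityʳ _) ⟩
      down x b                           ∎
    at-child : ¬ T (vert b) → parent b ≡ x → down x b ≈ ŵ u (φ b) * share b
    at-child b∉K ≡.refl = begin-equality
      down x b                            ≈⟨ trans (down-child b∉K) (up-top b∉K p) ⟩
      top (φ b)                           ≈⟨ reflexive (≡.cong top φb≡) ⟩
      ŵ (inj₁ (x , attachment-core q)) v * fibre v ⁻¹
        ≈⟨ *-cong (reflexive (≡.cong (λ z → ŵ z v) (core≡ ≡.refl)))
            (reflexive (≡.cong (λ z → fibre z ⁻¹) (≡.sym φb≡))) ⟩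
      ŵ u v * fibre (φ b) ⁻¹
        ≈⟨ *-congˡ (trans (*-congʳ (𝟙-yes (depth b ℕ.≤? 1) depth≤1)) (*-identityˡ _)) ⟨
      ŵ u v * share b                     ≈⟨ ŵ-share φb≡ ⟨
      ŵ u (φ b) * share b                 ∎
      where
      q = attached p b∉K (adj-sym b x (parent-adj b∉K))
      v = inj₂ (x , q)
      φb≡ : φ b ≡ v
      φb≡ = φ-child b∉K p q
      depth≤1 : depth b ℕ.≤ 1
      depth≤1 = ℕ.≤-reflexive (≡.trans (depth-parent b∉K) (≡.cong suc (depth-core x p)))
    elsewhere : ¬ T (vert b) → parent b ≢ x → down x b ≈ ŵ u (φ b) * share b
    elsewhere b∉K b≢x = trans (down-off (b≢x ∘ proj₁)) (sym (case depth b ℕ.≤? 1 of λ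
      { (no far)  → trans (*-congˡ (share-far far)) (zeroʳ _)
      ; (yes ≤1) → trans (*-congʳ (trans (reflexive (≡.cong (ŵ u) (φ-hanging b∉K ≡.refl (root-attached b∉K))))
          (Ŵ.off-edge u (inj₂ (root b , root-attached b∉K)) λ e → b≢x
              (≡.trans (≡.sym (root-near b∉K ≤1)) (≡.sym (toWitness {a? = x ≟ᵛ root b} e))))))
          (zeroˡ _) }))

  -- The vertex `a` receives mass from `φ a` only.
  ∑-k : ∀ (f : Ĝ.V → ℝ) a → ∑ (K̂ K) (λ u → f u * k u a) ≈ f (φ a) * share a
  ∑-k f a = trans
    (∑-single (K̂ K) (φ a) λ u u≢ → trans (*-congˡ (trans (*-congʳ (𝟙-no (φ a Ĝ.≟ u) (u≢ ∘ ≡.sym))) (zeroˡ _)))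
        (zeroʳ _))
    (*-congˡ (trans (*-congʳ (𝟙-yes (φ a Ĝ.≟ φ a) ≡.refl)) (*-identityˡ _)))

  deg-core : ∀ x p → W.deg x ≈ Ŵ.deg (inj₁ (x , p))
  deg-core x p = begin-equality
    ∑ G (w x)
      ≈⟨ sum-cong vertices (λ b → trans (w-core x p b) (sym (∑-k (ŵ u) b))) ⟩
    ∑ G (λ b → ∑ (K̂ K) (λ v → ŵ u v * k v b))
      ≈⟨ sum-swap vertices Ĝ.vertices (λ b v → ŵ u v * k v b) ⟩
    ∑ (K̂ K) (λ v → ∑ G (λ b → ŵ u v * k v b))
      ≈⟨ sum-cong Ĝ.vertices (λ v → trans (sum-*ˡ vertices (ŵ u v) (k v))
          (trans (*-congˡ (k-total v)) (*-identityʳ _))) ⟩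
    Ŵ.deg u ∎
    where u = inj₁ (x , p)

  push-p : ∀ x p b → Transport.push ℛ D̂ D k (L̂.p (inj₁ (x , p))) b ≈ L.p x b
  push-p x p b = begin-equality
    ∑ (K̂ K) (λ v → L̂.p u v * k v b)        ≈⟨ ∑-k (L̂.p u) b ⟩
    ŵ u (φ b) * Ŵ.deg u ⁻¹ * share b
      ≈⟨ solve 3 (λ w i s → w :* i :* s := w :* s :* i) refl (ŵ u (φ b)) (Ŵ.deg u ⁻¹) (share b) ⟩
    ŵ u (φ b) * share b * Ŵ.deg u ⁻¹        ≈⟨ *-cong (w-core x p b) (⁻¹-cong (deg-core x p)) ⟨
    L.p x b                                 ∎
    where u = inj₁ (x , p)

  -- No coupling of the measures at two core vertices has mass at a pair (z^∂ , z^∂), which is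
  -- the only place where the kernel k would increase distances.
  pendant-free : ∀ {α x p y q z} → x ≢ y →
                 (c : Curvature.Coupling ℛ (K̂ K) (Ŵ.μ α (inj₁ (x , p))) (Ŵ.μ α (inj₁ (y , q)))) →
                 Curvature.Coupling.π c (inj₂ z) (inj₂ z) ≈ 0#
  -- A pendant vertex has a single neighbour, so the walk at `x` or the walk at `y` misses it; the
  -- corresponding marginal bounds the entry.
  pendant-free {α} {x} {p} {y} {q} {z} x≢y c = case x ≟ᵛ proj₁ z of λ
    { (no x≢z)     → squeeze (≤-trans (Ĉ.π≤marginalˡ c (inj₂ z) (inj₂ z)) (≤-reflexive (vanish x≢z)))
    ; (yes ≡.refl) → squeeze (≤-trans (Ĉ.π≤marginalʳ c (inj₂ z) (inj₂ z))
        (≤-reflexive (vanish (x≢y ∘ ≡.sym)))) }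
    where
    squeeze : Curvature.Coupling.π c (inj₂ z) (inj₂ z) ≤ 0# → Curvature.Coupling.π c (inj₂ z) (inj₂ z) ≈ 0#
    squeeze ≤0 = antisym ≤0 (Curvature.Coupling.nonneg c (inj₂ z) (inj₂ z))
    vanish : ∀ {x p} → x ≢ proj₁ z → Ŵ.μ α (inj₁ (x , p)) (inj₂ z) ≈ 0#
    vanish {x} {p} x≢z = trans (L̂.μ≈ α (inj₁ (x , p)) (inj₂ z)) (trans
      (+-cong (trans (*-congˡ (Ĉ.δ-other {inj₁ (x , p)} {inj₂ z} λ ())) (zeroʳ _))
              (trans (*-congˡ (L̂.p-off-edge {inj₁ (x , p)} {inj₂ z} λ e → x≢z
                  (toWitness {a? = x ≟ᵛ proj₁ z} e))) (zeroʳ _)))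
      (+-identityˡ 0#))

  core-contracting : ∀ x y (xy : T (adj x y)) → T (edge x y) → L.Edge.NearlyContracting x y xy
  core-contracting x y xy e = CurvatureTransport.contracting-push ℛ D̂ D weight expanded
    (inj₁ (x , p)) (inj₁ (y , q)) x y e xy k k-nonneg k-total (k-core x p) (k-core y q) (push-p x p)
        (push-p y q)
    shorter (admissible⇒contracting D̂ weight admissible (inj₁ (x , p)) (inj₁ (y , q)) e)
    where
    open GraphDistance
    p = edge-vert x y e
    q = edge-vertʳ e
    x≢y : x ≢ y
    x≢y ≡.refl = adj-irr x xy
    shorter : ∀ {α} (c : Curvature.Coupling ℛ (K̂ K) (Ŵ.μ α (inj₁ (x , p))) (Ŵ.μ α (inj₁ (y , q)))) u u′ b b′ →
              Curvature.Coupling.π c u u′ ≈ 0# ⊎ k u b ≈ 0# ⊎ k u′ b′ ≈ 0# ⊎ d D b b′ ℕ.≤ d D̂ u u′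
    shorter c u u′ b b′ = case off-support u b of λ
      { (inj₁ k≈0) → inj₂ (inj₁ k≈0)
      ; (inj₂ cub) → case off-support u′ b′ of λ
        { (inj₁ k≈0) → inj₂ (inj₂ (inj₁ k≈0))
        ; (inj₂ cub′) → near-pair u u′ cub cub′ (u Ĝ.≟ u′) } }
      where
      off-support : ∀ u b → k u b ≈ 0# ⊎ Covers b u
      off-support u b = case φ b Ĝ.≟ u of λ
        { (no ≢u)      → inj₁ (trans (*-congʳ (𝟙-no (φ b Ĝ.≟ u) ≢u)) (zeroˡ _))
        ; (yes ≡.refl) → case depth b ℕ.≤? 1 of λ
          { (no far)  → inj₁ (trans (*-congˡ (share-far far)) (zeroʳ _))
          ; (yes ≤1) → inj₂ (covers ≤1) } }
      lifted : ∀ u u′ → Covers b u → Covers b′ u′ → (u ≡ u′ → ∃[ z ] u ≡ inj₁ z) → d D b b′ ℕ.≤ d D̂ u u′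
      lifted u u′ cub cub′ distinct = let m , m≤ , walk = lift-walk cub cub′ distinct (attained D̂ u u′) in
        ℕ.≤-trans (minimal D b b′ m walk) m≤
      -- Only a pendant vertex paired with itself fails to lift, and there the coupling has no mass.
      near-pair : ∀ u u′ → Covers b u → Covers b′ u′ → Dec (u ≡ u′) →
                  Curvature.Coupling.π c u u′ ≈ 0# ⊎ k u b ≈ 0# ⊎ k u′ b′ ≈ 0# ⊎ d D b b′ ℕ.≤ d D̂ u u′
      near-pair u        u′ cub cub′ (no u≢u′)    = inj₂
          (inj₂ (inj₂ (lifted u u′ cub cub′ λ u≡u′ → contradiction u≡u′ u≢u′)))
      near-pair (inj₁ z) _  cub cub′ (yes ≡.refl) = inj₂ (inj₂ (inj₂ (lifted _ _ cub cub′ λ _ → z , ≡.refl)))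
      near-pair (inj₂ z) _  cub cub′ (yes ≡.refl) = inj₁ (pendant-free x≢y c)

  children : V → ℝ
  children y = ∑ G (down y)

  -- A crude count: each of the N vertices of the graph is charged the weight of a child edge.
  children-bound : ∀ {y} → ¬ T (vert y) → children y ≤ N * (up y * up y * ε)
  children-bound {y} y∉K = begin
    ∑ G (down y)                             ≤⟨ sum-mono-≤ vertices bound ⟩
    ∑ G (λ _ → 1# * (up y * up y * ε))       ≈⟨ sum-*ʳ vertices _ _ ⟩
    N * (up y * up y * ε)                    ∎
    where
    0≤sq : 0# ≤ up y * up y * ε
    0≤sq = *-nonneg (*-nonneg (proj₁ (up-positive y∉K)) (proj₁ (up-positive y∉K))) (proj₁ 0<ε)
    bound : ∀ b → down y b ≤ 1# * (up y * up y * ε)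
    bound b = case IsChild? y b of λ
      { (yes (≡.refl , b∉K)) → ≤-reflexive (trans (down-child b∉K)
          (trans (up-child b∉K y∉K) (sym (*-identityˡ _))))
      ; (no ¬child)          → ≤-trans (≤-reflexive (down-off ¬child))
          (≤-trans 0≤sq (≤-reflexive (sym (*-identityˡ _)))) }

  deg-outside : ∀ {y} → ¬ T (vert y) → W.deg y ≈ children y + up y
  deg-outside {y} y∉K = begin-equality
    ∑ G (λ b → inside y b + (down y b + down b y))
      ≈⟨ sum-cong vertices (λ b → trans (+-congʳ (inside-offˡ y∉K)) (+-identityˡ _)) ⟩
    ∑ G (λ b → down y b + down b y)
      ≈⟨ sum-+ vertices (down y) (λ b → down b y) ⟩
    children y + ∑ G (λ b → down b y)
      ≈⟨ +-congˡ (trans (∑-single G (parent y) λ b b≢ → down-off λ (p≡b , _) → b≢ (≡.sym p≡b))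
          (down-child y∉K)) ⟩
    children y + up y ∎

  -- The origin of the factor 2 in `D₀`: at a tree vertex the child edges together and the parent
  -- edge each weigh at most `Total`. A core vertex keeps its degree in K̂.
  deg≤D₀ : ∀ x → W.deg x ≤ D₀
  deg≤D₀ x = case T? (vert x) of λ
    { (yes p)  → ≤-trans (≤-reflexive (deg-core x p)) (≤-trans (deĝ≤Total _) Total≤D₀)
    ; (no x∉K) → begin
        W.deg x                               ≈⟨ deg-outside x∉K ⟩
        children x + up x
          ≤⟨ +-mono-≤ (≤-trans (children-bound x∉K) (sq≤ x∉K)) (up≤Total x∉K) ⟩
        D₀                                    ∎ }
    where
    sq≤ : ¬ T (vert x) → N * (up x * up x * ε) ≤ Total
    sq≤ x∉K = begin
      N * (up x * up x * ε)
        ≈⟨ solve 3 (λ n u e → n :* (u :* u :* e) := u :* (n :* u :* e)) refl N (up x) ε ⟩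
      up x * (N * up x * ε)
        ≤⟨ *-monoˡ-≤ 0≤up (*-monoʳ-≤ (proj₁ 0<ε) (*-monoˡ-≤ (≤-trans 0≤1 1≤N) (up≤Total x∉K))) ⟩
      up x * (N * Total * ε)    ≤⟨ *-monoˡ-≤ 0≤up N*Total*ε≤1 ⟩
      up x * 1#                 ≈⟨ *-identityʳ _ ⟩
      up x                      ≤⟨ up≤Total x∉K ⟩
      Total                     ∎
      where 0≤up = proj₁ (up-positive x∉K)

  w-parent : ∀ {y} → ¬ T (vert y) → w (parent y) y ≈ up y
  w-parent {y} y∉K = begin-equality
    inside (parent y) y + (down (parent y) y + down y (parent y))
      ≈⟨ +-cong (trans (inside-sym (parent y) y) (inside-offˡ y∉K))
          (+-cong (down-child y∉K) (down-off no-cycle)) ⟩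
    0# + (up y + 0#)
      ≈⟨ trans (+-identityˡ _) (+-identityʳ _) ⟩
    up y ∎
    where
    -- Such a cycle would make the depth of `y` exceed itself by 2.
    no-cycle : ¬ (parent (parent y) ≡ y × ¬ T (vert (parent y)))
    no-cycle (pp≡y , p∉K) = ℕ.<-irrefl ≡.refl (ℕ.≤-trans (ℕ.n≤1+n _) (ℕ.≤-reflexive
      (≡.sym (≡.trans (depth-parent y∉K) (≡.cong suc
          (≡.trans (depth-parent p∉K) (≡.cong (suc ∘ depth) pp≡y)))))))

  -- The factor at `y` is exactly the weight of its child edges, at most N ε (up y)², and the factor
  -- at the parent is at most `D₀`; the choice of `ε` makes N D₀ ε = 1. The weight is passed as `m`
  -- so that either orientation of the edge can be used.
  parent-dominant : ∀ {y m} → ¬ T (vert y) → m ≈ up y →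
                    (W.deg (parent y) - m) * (W.deg y - m) ≤ m * m
  parent-dominant {y} {m} y∉K m≈ = begin
    (W.deg (parent y) - m) * (W.deg y - m)
      ≈⟨ *-congˡ (trans (+-cong (deg-outside y∉K) (-‿cong m≈)) (solve 2 (λ c u → c :+ u :- u := c)
          refl (children y) (up y))) ⟩
    (W.deg (parent y) - m) * children y
      ≤⟨ *-monoʳ-≤ (sum-nonneg vertices (down-nonneg y)) (≤-trans below-deg (deg≤D₀ (parent y))) ⟩
    D₀ * children y
      ≤⟨ *-monoˡ-≤ (≤-trans (proj₁ 0<Total) Total≤D₀) (children-bound y∉K) ⟩
    D₀ * (N * (up y * up y * ε))
      ≈⟨ solve 4 (λ d n u e → d :* (n :* (u :* u :* e)) := (n :* d :* e) :* (u :* u)) refl D₀ N (up y) ε ⟩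
    (N * D₀ * ε) * (up y * up y)
      ≈⟨ trans (*-congʳ (⁻¹-inverseʳ 0<ND₀)) (*-identityˡ _) ⟩
    up y * up y
      ≈⟨ *-cong m≈ m≈ ⟨
    m * m ∎
    where
    below-deg : W.deg (parent y) - m ≤ W.deg (parent y)
    below-deg = certify m (≤-trans (proj₁ (up-positive y∉K)) (≤-reflexive (sym m≈)))
      (solve 2 (λ d m → d := d :- m :+ m) refl (W.deg (parent y)) m)

  expanded-contracting : ∀ x y (xy : T (adj x y)) → L.Edge.NearlyContracting x y xy
  expanded-contracting x y xy = case edges xy of λ
    { (inj₁ e)                     → core-contracting x y xy e
    ; (inj₂ (inj₁ (x∉K , ≡.refl))) → L.Edge.dominant⇒contracting x y xy
        (≤-trans (≤-reflexive (*-comm _ _)) (parent-dominant x∉K (trans (W.w-sym x y) (w-parent x∉K))))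
    ; (inj₂ (inj₂ (y∉K , ≡.refl))) → L.Edge.dominant⇒contracting x y xy (parent-dominant y∉K (w-parent y∉K)) }

  expanded-admissible : Curvature.Admissible ℛ G D expanded
  expanded-admissible = contracting⇒admissible D expanded expanded-contracting

-- Equivalence of finite distortion for G and K̂

theorem1p2 : (ℛ : CompleteOrderedField) (G : FiniteGraph) → Connected G →
    (K : Subgraph G) → Is2Core K → Subgraph.Nonempty K →
    Curvature.DN<∞ ℛ G ⇔ Curvature.DN<∞ ℛ (K̂ K)
theorem1p2 ℛ G connected K is2Core nonempty = mk⇔
  (λ finite →
    let D , weight , admissible = DistortionNumber.DN<∞⇒admissible ℛ G edge-G finite
    in DistortionNumber.admissible⇒DN<∞ ℛ (K̂ K) edge-K̂ D̂₀
         (Collapse.collapsed ℛ K hanging D D̂₀ weight admissible)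
         (Collapse.collapsed-admissible ℛ K hanging D D̂₀ weight admissible))
  (λ finite →
    let D̂ , weight , admissible = DistortionNumber.DN<∞⇒admissible ℛ (K̂ K) edge-K̂ finite
    in DistortionNumber.admissible⇒DN<∞ ℛ G edge-G D₀
         (Expand.expanded ℛ K hanging D₀ D̂ edge-K̂ weight admissible)
         (Expand.expanded-admissible ℛ K hanging D₀ D̂ edge-K̂ weight admissible))
  where
  open FiniteGraph G using (V; adj; vertices)
  open Subgraph K
  hanging : Hanging K (λ _ → true)
  hanging = Peeling.hanging K connected is2Core nonempty
  D₀ : GraphDistance G
  D₀ = Walks.graphDistance G connected
  D̂₀ : GraphDistance (K̂ K)
  D̂₀ = Walks.graphDistance (K̂ K) (Retraction.K̂-connected K hanging connected)
  -- A vertex of degree at least 2 in the core yields an edge, which places both G and K̂ under the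
  -- infimum clause of the definition of DN.
  core-edge : ∃[ x ] ∃[ y ] T (edge x y)
  core-edge =
    let x , x∈K = nonempty
        y , _ , xy = count-member (edge x) vertices (ℕ.≤-trans (ℕ.n≤1+n 1) (proj₁ is2Core x x∈K))
    in x , y , xy
  edge-G : HasEdge G
  edge-G = let x , y , xy = core-edge in x , y , edge-adj x y xy
  edge-K̂ : HasEdge (K̂ K)
  edge-K̂ = let x , y , xy = core-edge in
    inj₁ (x , edge-vert x y xy) , inj₁ (y , edge-vert y x (edge-sym x y xy)) , xy
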